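{- For any $a_1,a_2,a_3,b_1,b_2,b_3\in\mathbb{Z}_{\ge0}$, the following equality of rational functions in $t_1,t_2,t_3,\eta$ holds: $$\sum_{l_1,l_2,l_3}W^{\mathsf s}_{\eta t_2,\eta t_3}(a_3,a_2;l_3,l_2)\,W^{\mathsf s}_{t_1,t_3}(l_3,a_1;b_3,l_1)\,W^{\mathsf s}_{\eta t_1,\eta t_2}(l_2,l_1;b_2,b_1)$$ $$=\sum_{l_1,l_2,l_3}W^{\mathsf s}_{t_1,t_2}(a_2,a_1;l_2,l_1)\,W^{\mathsf s}_{\eta t_1,\eta t_3}(a_3,l_1;l_3,b_1)\,W^{\mathsf s}_{t_2,t_3}(l_3,l_2;b_3,b_2),$$ where the sums are over $l_1,l_2,l_3\in\mathbb{Z}_{\ge0}$.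
   Context: $q$ is a fixed generic parameter, $(x;q)_n:=\prod_{i=1}^n(1-xq^{i-1})$, $(x;q)_0:=1$. For $i,j,k,l\in\mathbb{Z}_{\ge0}$, $$W^{\mathsf s}_{t,s}(i,j;k,l):=\mathbf{1}_{i+j=k+l}\,\mathbf{1}_{i\ge l}\,s^{2l}t^{ -2l}\frac{(s^2/t^2;q)_{i-l}(t^2;q)_l}{(s^2;q)_i}\frac{(q;q)_i}{(q;q)_{i-l}(q;q)_l}.$$ -}

module Defs where

open import Level using (Level; _⊔_)
open import Algebra.Bundles using (CommutativeRing)
open import Algebra.Structures using (IsCommutativeRing)
open import Algebra.Apartness.Bundles using (HeytingField; HeytingCommutativeRing)
open import Algebra.Definitions using (Invertible)
open import Data.Fin.Base using (Fin; zero; suc; toℕ)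
open import Data.Fin.Patterns using (0F; 1F; 2F; 3F)
open import Data.List.Base using (List; []; _∷_; map)
open import Data.Nat.Base as ℕ using (ℕ; zero; suc; _∸_)
import Data.Nat.Properties as ℕₚ
open import Data.Product.Base using (_×_; _,_; proj₁; proj₂; ∃-syntax)
open import Data.Sum.Base using (_⊎_; inj₁; inj₂)
open import Relation.Binary.PropositionalEquality as ≡ using (_≡_)
open import Relation.Binary.Structures using (IsEquivalence)
open import Relation.Nullary.Decidable.Core using (Dec; yes; no)
open import Relation.Nullary.Negation using (¬_; contradiction)
import Algebra.Properties.Monoid.Sum
import Algebra.Properties.Semiring.Exp
import Algebra.Properties.Ring
import Algebra.Solver.Ring.NaturalCoefficients.Default

private
  variable
    c ℓ ℓ₂ : Level

module _ (R : CommutativeRing c ℓ) where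
  open CommutativeRing R

  -- Not a zero divisor.
  Regular : Carrier → Set (c ⊔ ℓ)
  Regular b = ∀ x → b * x ≈ 0# → x ≈ 0#

module RegularProperties (R : CommutativeRing c ℓ) where
  open CommutativeRing R

  regular-* : ∀ {x y} → Regular R x → Regular R y → Regular R (x * y)
  regular-* rx ry z xyz≈0 = ry z (rx _ (trans (sym (*-assoc _ _ _)) xyz≈0))

  regular-1 : Regular R 1#
  regular-1 x 1x≈0 = trans (sym (*-identityˡ x)) 1x≈0

  regular-resp : ∀ {x y} → x ≈ y → Regular R x → Regular R y
  regular-resp x≈y rx z yz≈0 = rx z (trans (*-congʳ x≈y) yz≈0)

  invertible⇒regular : ∀ {x} → Invertible _≈_ 1# _*_ x → Regular R x
  invertible⇒regular {x} (y , yx≈1 , _) z xz≈0 =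
    trans (sym (*-identityˡ z))
    (trans (*-congʳ (sym yx≈1))
    (trans (*-assoc y x z)
    (trans (*-congˡ xz≈0) (zeroʳ y))))

-- Univariate polynomials R[X]: lists of coefficients, constant term first,
-- compared coefficient by coefficient (so trailing zeros are immaterial).
module Polynomial (R : CommutativeRing c ℓ) where
  open CommutativeRing R
  open Algebra.Properties.Ring ring using (-0#≈0#)
  private
    module S = Algebra.Solver.Ring.NaturalCoefficients.Default commutativeSemiring
  open S using (solve; _:=_; _:+_; _:*_)

  Poly : Set c
  Poly = List Carrier

  coeff : Poly → ℕ → Carrier
  coeff []      _       = 0#
  coeff (a ∷ p) zero    = a
  coeff (a ∷ p) (suc n) = coeff p n

  infix 4 _≈ₚ_
  record _≈ₚ_ (p r : Poly) : Set ℓ where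
    constructor mk
    field coeff-≈ : ∀ n → coeff p n ≈ coeff r n
  open _≈ₚ_ public

  infixl 6 _+ₚ_
  infixl 7 _*ₚ_ _·ₚ_
  infix  8 -ₚ_

  _+ₚ_ : Poly → Poly → Poly
  []      +ₚ r       = r
  (a ∷ p) +ₚ []      = a ∷ p
  (a ∷ p) +ₚ (b ∷ r) = a + b ∷ p +ₚ r

  -ₚ_ : Poly → Poly
  -ₚ p = map (-_) p

  _·ₚ_ : Carrier → Poly → Poly
  a ·ₚ p = map (a *_) p

  _*ₚ_ : Poly → Poly → Poly
  []      *ₚ r = []
  (a ∷ p) *ₚ r = a ·ₚ r +ₚ (0# ∷ p *ₚ r)

  constant : Carrier → Poly
  constant a = a ∷ []

  X : Poly
  X = 0# ∷ 1# ∷ []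

  coeff-+ : ∀ p r n → coeff (p +ₚ r) n ≈ coeff p n + coeff r n
  coeff-+ []      r       n       = sym (+-identityˡ _)
  coeff-+ (a ∷ p) []      n       = sym (+-identityʳ _)
  coeff-+ (a ∷ p) (b ∷ r) zero    = refl
  coeff-+ (a ∷ p) (b ∷ r) (suc n) = coeff-+ p r n

  coeff-neg : ∀ p n → coeff (-ₚ p) n ≈ - coeff p n
  coeff-neg []      n       = sym -0#≈0#
  coeff-neg (a ∷ p) zero    = refl
  coeff-neg (a ∷ p) (suc n) = coeff-neg p n

  coeff-· : ∀ a p n → coeff (a ·ₚ p) n ≈ a * coeff p n
  coeff-· a []      n       = sym (zeroʳ a)
  coeff-· a (b ∷ p) zero    = refl
  coeff-· a (b ∷ p) (suc n) = coeff-· a p n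

  coeff-*-zero : ∀ a p r → coeff ((a ∷ p) *ₚ r) 0 ≈ a * coeff r 0
  coeff-*-zero a p r = trans (coeff-+ (a ·ₚ r) (0# ∷ p *ₚ r) 0)
    (trans (+-identityʳ _) (coeff-· a r 0))

  coeff-*-suc : ∀ a p r n →
    coeff ((a ∷ p) *ₚ r) (suc n) ≈ a * coeff r (suc n) + coeff (p *ₚ r) n
  coeff-*-suc a p r n = trans (coeff-+ (a ·ₚ r) (0# ∷ p *ₚ r) (suc n))
    (+-congʳ (coeff-· a r (suc n)))

  ≈ₚ-isEquivalence : IsEquivalence _≈ₚ_
  ≈ₚ-isEquivalence = record
    { refl  = mk λ _ → refl
    ; sym   = λ e → mk λ n → sym (coeff-≈ e n)
    ; trans = λ e f → mk λ n → trans (coeff-≈ e n) (coeff-≈ f n)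
    }
  private module E = IsEquivalence ≈ₚ-isEquivalence

  +ₚ-cong : ∀ {p p′ r r′} → p ≈ₚ p′ → r ≈ₚ r′ → p +ₚ r ≈ₚ p′ +ₚ r′
  +ₚ-cong {p} {p′} {r} {r′} e f = mk λ n → trans (coeff-+ p r n)
    (trans (+-cong (coeff-≈ e n) (coeff-≈ f n)) (sym (coeff-+ p′ r′ n)))

  +ₚ-assoc : ∀ p r s → (p +ₚ r) +ₚ s ≈ₚ p +ₚ (r +ₚ s)
  +ₚ-assoc p r s = mk λ n →
    trans (coeff-+ (p +ₚ r) s n)
    (trans (+-congʳ (coeff-+ p r n))
    (trans (+-assoc _ _ _)
    (trans (+-congˡ (sym (coeff-+ r s n))) (sym (coeff-+ p (r +ₚ s) n)))))

  +ₚ-comm : ∀ p r → p +ₚ r ≈ₚ r +ₚ p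
  +ₚ-comm p r = mk λ n →
    trans (coeff-+ p r n) (trans (+-comm _ _) (sym (coeff-+ r p n)))

  +ₚ-inverseˡ : ∀ p → -ₚ p +ₚ p ≈ₚ []
  +ₚ-inverseˡ p = mk λ n → trans (coeff-+ (-ₚ p) p n)
    (trans (+-congʳ (coeff-neg p n)) (-‿inverseˡ _))

  -ₚ-cong : ∀ {p r} → p ≈ₚ r → -ₚ p ≈ₚ -ₚ r
  -ₚ-cong {p} {r} e = mk λ n →
    trans (coeff-neg p n) (trans (-‿cong (coeff-≈ e n)) (sym (coeff-neg r n)))

  coeff-*-congˡ : ∀ p {r r′} → r ≈ₚ r′ → ∀ n → coeff (p *ₚ r) n ≈ coeff (p *ₚ r′) n
  coeff-*-congˡ []      e n = refl
  coeff-*-congˡ (a ∷ p) {r} {r′} e zero =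
    trans (coeff-*-zero a p r)
    (trans (*-congˡ (coeff-≈ e 0)) (sym (coeff-*-zero a p r′)))
  coeff-*-congˡ (a ∷ p) {r} {r′} e (suc n) =
    trans (coeff-*-suc a p r n)
    (trans (+-cong (*-congˡ (coeff-≈ e (suc n))) (coeff-*-congˡ p e n))
      (sym (coeff-*-suc a p r′ n)))

  coeff-*-[] : ∀ p n → coeff (p *ₚ []) n ≈ 0#
  coeff-*-[] []      n       = refl
  coeff-*-[] (a ∷ p) zero    = refl
  coeff-*-[] (a ∷ p) (suc n) = coeff-*-[] p n

  coeff-*-∷ : ∀ p b r n →
    coeff (p *ₚ (b ∷ r)) n ≈ coeff (b ·ₚ p +ₚ (0# ∷ p *ₚ r)) n
  coeff-*-∷ []      b r zero    = refl
  coeff-*-∷ []      b r (suc n) = refl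
  coeff-*-∷ (a ∷ p) b r zero    = +-congʳ (*-comm a b)
  coeff-*-∷ (a ∷ p) b r (suc n) =
    trans (coeff-*-suc a p (b ∷ r) n)
    (trans (+-congˡ (trans (coeff-*-∷ p b r n) (coeff-+ (b ·ₚ p) (0# ∷ p *ₚ r) n)))
    (trans (solve 3 (λ x y z → (x :+ (y :+ z)) := (y :+ (x :+ z))) refl
             (a * coeff r n) (coeff (b ·ₚ p) n) (coeff (0# ∷ p *ₚ r) n))
    (trans (+-congˡ (sym (trans (coeff-+ (a ·ₚ r) (0# ∷ p *ₚ r) n)
                              (+-congʳ (coeff-· a r n)))))
      (sym (coeff-+ (b ·ₚ p) ((a ∷ p) *ₚ r) n)))))

  *ₚ-comm : ∀ p r → p *ₚ r ≈ₚ r *ₚ p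
  *ₚ-comm []      r = mk λ n → sym (coeff-*-[] r n)
  *ₚ-comm (a ∷ p) r = E.sym (E.trans (mk (coeff-*-∷ r a p))
    (+ₚ-cong E.refl (shift (*ₚ-comm r p))))
    where
    shift : ∀ {u v} → u ≈ₚ v → (0# ∷ u) ≈ₚ (0# ∷ v)
    shift e = mk λ { zero → refl ; (suc n) → coeff-≈ e n }

  *ₚ-congˡ : ∀ p {r r′} → r ≈ₚ r′ → p *ₚ r ≈ₚ p *ₚ r′
  *ₚ-congˡ p e = mk (coeff-*-congˡ p e)

  *ₚ-cong : ∀ {p p′ r r′} → p ≈ₚ p′ → r ≈ₚ r′ → p *ₚ r ≈ₚ p′ *ₚ r′
  *ₚ-cong {p} {p′} {r} {r′} e f = E.trans (*ₚ-congˡ p f)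
    (E.trans (*ₚ-comm p r′) (E.trans (*ₚ-congˡ r′ e) (*ₚ-comm r′ p′)))

  coeff-*-distribˡ : ∀ p r s n →
    coeff (p *ₚ (r +ₚ s)) n ≈ coeff (p *ₚ r) n + coeff (p *ₚ s) n
  coeff-*-distribˡ []      r s n = sym (+-identityˡ _)
  coeff-*-distribˡ (a ∷ p) r s zero =
    trans (coeff-*-zero a p (r +ₚ s))
    (trans (*-congˡ (coeff-+ r s 0))
    (trans (distribˡ a _ _)
      (sym (+-cong (coeff-*-zero a p r) (coeff-*-zero a p s)))))
  coeff-*-distribˡ (a ∷ p) r s (suc n) =
    trans (coeff-*-suc a p (r +ₚ s) n)
    (trans (+-cong (*-congˡ (coeff-+ r s (suc n))) (coeff-*-distribˡ p r s n))
    (trans (solve 5 (λ x y z u v →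
              (x :* (y :+ z) :+ (u :+ v)) := ((x :* y :+ u) :+ (x :* z :+ v))) refl
              a (coeff r (suc n)) (coeff s (suc n)) (coeff (p *ₚ r) n) (coeff (p *ₚ s) n))
      (sym (+-cong (coeff-*-suc a p r n) (coeff-*-suc a p s n)))))

  *ₚ-distribˡ : ∀ p r s → p *ₚ (r +ₚ s) ≈ₚ p *ₚ r +ₚ p *ₚ s
  *ₚ-distribˡ p r s = mk λ n →
    trans (coeff-*-distribˡ p r s n) (sym (coeff-+ (p *ₚ r) (p *ₚ s) n))

  *ₚ-distribʳ : ∀ p r s → (r +ₚ s) *ₚ p ≈ₚ r *ₚ p +ₚ s *ₚ p
  *ₚ-distribʳ p r s = E.trans (*ₚ-comm (r +ₚ s) p)
    (E.trans (*ₚ-distribˡ p r s) (+ₚ-cong (*ₚ-comm p r) (*ₚ-comm p s)))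

  coeff-·-* : ∀ a r s n → coeff ((a ·ₚ r) *ₚ s) n ≈ a * coeff (r *ₚ s) n
  coeff-·-* a []      s n    = sym (zeroʳ a)
  coeff-·-* a (b ∷ r) s zero =
    trans (coeff-*-zero (a * b) (a ·ₚ r) s)
    (trans (*-assoc a b _) (*-congˡ (sym (coeff-*-zero b r s))))
  coeff-·-* a (b ∷ r) s (suc n) =
    trans (coeff-*-suc (a * b) (a ·ₚ r) s n)
    (trans (+-cong (*-assoc a b _) (coeff-·-* a r s n))
    (trans (sym (distribˡ a _ _)) (*-congˡ (sym (coeff-*-suc b r s n)))))

  coeff-*-assoc : ∀ p r s n → coeff ((p *ₚ r) *ₚ s) n ≈ coeff (p *ₚ (r *ₚ s)) n
  coeff-*-assoc []      r s n = refl
  coeff-*-assoc (a ∷ p) r s n =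
    trans (coeff-≈ (*ₚ-distribʳ s (a ·ₚ r) (0# ∷ p *ₚ r)) n)
    (trans (coeff-+ ((a ·ₚ r) *ₚ s) ((0# ∷ p *ₚ r) *ₚ s) n)
    (trans (+-cong (trans (coeff-·-* a r s n) (sym (coeff-· a (r *ₚ s) n))) (shifted n))
      (sym (coeff-+ (a ·ₚ (r *ₚ s)) (0# ∷ p *ₚ (r *ₚ s)) n))))
    where
    shifted : ∀ n → coeff ((0# ∷ p *ₚ r) *ₚ s) n ≈ coeff (0# ∷ p *ₚ (r *ₚ s)) n
    shifted zero    = trans (coeff-*-zero 0# (p *ₚ r) s) (zeroˡ _)
    shifted (suc n) = trans (coeff-*-suc 0# (p *ₚ r) s n)
      (trans (+-cong (zeroˡ _) (coeff-*-assoc p r s n)) (+-identityˡ _))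

  *ₚ-identityˡ : ∀ p → constant 1# *ₚ p ≈ₚ p
  *ₚ-identityˡ p = mk λ where
    zero    → trans (coeff-*-zero 1# [] p) (*-identityˡ _)
    (suc n) → trans (coeff-*-suc 1# [] p n) (trans (+-identityʳ _) (*-identityˡ _))

  isCommutativeRingₚ : IsCommutativeRing _≈ₚ_ _+ₚ_ _*ₚ_ -ₚ_ [] (constant 1#)
  isCommutativeRingₚ = record
    { isRing = record
      { +-isAbelianGroup = record
        { isGroup = record
          { isMonoid = record
            { isSemigroup = record
              { isMagma = record { isEquivalence = ≈ₚ-isEquivalence ; ∙-cong = +ₚ-cong }
              ; assoc = +ₚ-assoc
              }
            ; identity = (λ _ → E.refl) , λ p → +ₚ-comm p []
            }
          ; inverse = +ₚ-inverseˡ , λ p → E.trans (+ₚ-comm p (-ₚ p)) (+ₚ-inverseˡ p)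
          ; ⁻¹-cong = -ₚ-cong
          }
        ; comm = +ₚ-comm
        }
      ; *-cong = *ₚ-cong
      ; *-assoc = λ p r s → mk (coeff-*-assoc p r s)
      ; *-identity = *ₚ-identityˡ , λ p → E.trans (*ₚ-comm p _) (*ₚ-identityˡ p)
      ; distrib = *ₚ-distribˡ , *ₚ-distribʳ
      }
    ; *-comm = *ₚ-comm
    }

  polynomialRing : CommutativeRing c ℓ
  polynomialRing = record { isCommutativeRing = isCommutativeRingₚ }

  coeff₀-* : ∀ p r → coeff (p *ₚ r) 0 ≈ coeff p 0 * coeff r 0
  coeff₀-* []      r = sym (zeroˡ _)
  coeff₀-* (a ∷ p) r = coeff-*-zero a p r

  coeff₀-regular : ∀ p → Regular R (coeff p 0) → Regular polynomialRing p
  coeff₀-regular p reg []      e = E.refl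
  coeff₀-regular p reg (b ∷ r) e = mk λ where
      zero    → b≈0
      (suc n) → coeff-≈ (coeff₀-regular p reg r (mk tail≈0)) n
    where
    e′ : ∀ n → coeff (b ·ₚ p +ₚ (0# ∷ p *ₚ r)) n ≈ 0#
    e′ n = trans (sym (coeff-*-∷ p b r n)) (coeff-≈ e n)
    b≈0 : b ≈ 0#
    b≈0 = reg b (trans (sym (coeff₀-* p (b ∷ r))) (coeff-≈ e 0))
    tail≈0 : ∀ n → coeff (p *ₚ r) n ≈ 0#
    tail≈0 n = trans (sym (+-identityˡ _))
      (trans (+-congʳ (sym (trans (coeff-· b p (suc n)) (trans (*-congʳ b≈0) (zeroˡ _)))))
      (trans (sym (coeff-+ (b ·ₚ p) (0# ∷ p *ₚ r) (suc n))) (e′ (suc n))))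

  X-regular : Regular polynomialRing X
  X-regular r e = mk λ n →
    trans (sym (coeff-≈ (*ₚ-identityˡ r) n))
    (trans (sym (+-identityˡ _))
    (trans (+-congʳ (sym (zeroˡ _)))
    (trans (sym (coeff-*-suc 0# (constant 1#) r n)) (coeff-≈ e (suc n)))))

  constant-regular : ∀ {a} → Regular R a → Regular polynomialRing (constant a)
  constant-regular {a} reg = coeff₀-regular (constant a) reg

  constant-* : ∀ a b → constant (a * b) ≈ₚ constant a *ₚ constant b
  constant-* a b = mk λ where
    zero          → sym (+-identityʳ _)
    (suc n)       → refl

-- R[x₀,…,xₙ₋₁], built as R[xₙ₋₁]⋯[x₀].
module Multivariate (R : CommutativeRing c ℓ) where

  MvPoly : ℕ → CommutativeRing c ℓ
  MvPoly zero    = R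
  MvPoly (suc n) = Polynomial.polynomialRing (MvPoly n)

  module Mv (n : ℕ) = CommutativeRing (MvPoly n)
  private module R = CommutativeRing R

  var : ∀ {n} → Fin n → Mv.Carrier n
  var {suc n} zero    = Polynomial.X (MvPoly n)
  var {suc n} (suc i) = Polynomial.constant (MvPoly n) (var i)

  const : ∀ n → R.Carrier → Mv.Carrier n
  const zero    a = a
  const (suc n) a = Polynomial.constant (MvPoly n) (const n a)

  constantTerm : ∀ n → Mv.Carrier n → R.Carrier
  constantTerm zero    p = p
  constantTerm (suc n) p = constantTerm n (Polynomial.coeff (MvPoly n) p 0)

  constantTerm-cong : ∀ n {p r} → Mv._≈_ n p r → constantTerm n p R.≈ constantTerm n r
  constantTerm-cong zero    e = e
  constantTerm-cong (suc n) e = constantTerm-cong n (Polynomial.coeff-≈ e 0)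

  constantTerm-+ : ∀ n p r →
    constantTerm n (Mv._+_ n p r) R.≈ constantTerm n p R.+ constantTerm n r
  constantTerm-+ zero    p r = R.refl
  constantTerm-+ (suc n) p r =
    R.trans (constantTerm-cong n (Polynomial.coeff-+ (MvPoly n) p r 0)) (constantTerm-+ n _ _)

  constantTerm-* : ∀ n p r →
    constantTerm n (Mv._*_ n p r) R.≈ constantTerm n p R.* constantTerm n r
  constantTerm-* zero    p r = R.refl
  constantTerm-* (suc n) p r =
    R.trans (constantTerm-cong n (Polynomial.coeff₀-* (MvPoly n) p r)) (constantTerm-* n _ _)

  constantTerm-neg : ∀ n p → constantTerm n (Mv.-_ n p) R.≈ R.- constantTerm n p
  constantTerm-neg zero    p = R.refl
  constantTerm-neg (suc n) p =
    R.trans (constantTerm-cong n (Polynomial.coeff-neg (MvPoly n) p 0)) (constantTerm-neg n _)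

  constantTerm-0 : ∀ n → constantTerm n (Mv.0# n) R.≈ R.0#
  constantTerm-0 zero    = R.refl
  constantTerm-0 (suc n) = constantTerm-0 n

  constantTerm-1 : ∀ n → constantTerm n (Mv.1# n) R.≈ R.1#
  constantTerm-1 zero    = R.refl
  constantTerm-1 (suc n) = constantTerm-1 n

  constantTerm-var : ∀ n (i : Fin n) → constantTerm n (var i) R.≈ R.0#
  constantTerm-var (suc n) zero    = constantTerm-0 n
  constantTerm-var (suc n) (suc i) = constantTerm-var n i

  constantTerm-regular : ∀ n p → Regular R (constantTerm n p) → Regular (MvPoly n) p
  constantTerm-regular zero    p reg = reg
  constantTerm-regular (suc n) p reg =
    Polynomial.coeff₀-regular (MvPoly n) p (constantTerm-regular n _ reg)

  var-regular : ∀ n (i : Fin n) → Regular (MvPoly n) (var i)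
  var-regular (suc n) zero    = Polynomial.X-regular (MvPoly n)
  var-regular (suc n) (suc i) = Polynomial.constant-regular (MvPoly n) (var-regular n i)

  constantTerm-const : ∀ n a → constantTerm n (const n a) R.≈ a
  constantTerm-const zero    a = R.refl
  constantTerm-const (suc n) a = constantTerm-const n a

-- Total ring of fractions; for an integral domain, where the regular elements
-- are the nonzero ones, this is the field of fractions.
module FractionRing (R : CommutativeRing c ℓ) where
  open CommutativeRing R
  open RegularProperties R
  open Algebra.Properties.Ring ring using (-‿distribˡ-*; -‿distribʳ-*)
  private
    module S = Algebra.Solver.Ring.NaturalCoefficients.Default commutativeSemiring
  open S using (solve; _:=_; _:+_; _:*_)

  record Fraction : Set (c ⊔ ℓ) where
    no-eta-equality
    pattern
    constructor frac
    field
      num         : Carrier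
      den         : Carrier
      den-regular : Regular R den
  open Fraction public

  infix 4 _≈f_
  record _≈f_ (x y : Fraction) : Set ℓ where
    constructor mk
    field cross : num x * den y ≈ num y * den x
  open _≈f_ public

  _+f_ : Fraction → Fraction → Fraction
  frac a b rb +f frac c d rd = frac (a * d + c * b) (b * d) (regular-* rb rd)

  _*f_ : Fraction → Fraction → Fraction
  frac a b rb *f frac c d rd = frac (a * c) (b * d) (regular-* rb rd)

  -f_ : Fraction → Fraction
  -f frac a b rb = frac (- a) b rb

  embed : Carrier → Fraction
  embed a = frac a 1# regular-1

  private
    cancel : ∀ {b x y} → Regular R b → b * x ≈ b * y → x ≈ y
    cancel {b} {x} {y} rb e =
      trans (sym (+-identityʳ x))
      (trans (+-congˡ (sym (-‿inverseˡ y)))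
      (trans (sym (+-assoc x (- y) y))
      (trans (+-congʳ (rb (x - y)
        (trans (distribˡ b x (- y))
        (trans (+-congˡ (sym (-‿distribʳ-* b y)))
        (trans (+-congʳ e) (-‿inverseʳ _))))))
      (+-identityˡ y))))

  ≈f-trans : ∀ {x y z} → x ≈f y → y ≈f z → x ≈f z
  ≈f-trans {frac a b rb} {frac c d rd} {frac e f rf} (mk p) (mk r) = mk (cancel rd
    (trans (solve 3 (λ d a f → (d :* (a :* f)) := ((a :* d) :* f)) refl d a f)
    (trans (*-congʳ p)
    (trans (solve 3 (λ c b f → (c :* b :* f) := ((c :* f) :* b)) refl c b f)
    (trans (*-congʳ r)
      (solve 3 (λ e d b → (e :* d :* b) := (d :* (e :* b))) refl e d b))))))

  ≈f-isEquivalence : IsEquivalence _≈f_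
  ≈f-isEquivalence = record
    { refl  = mk refl
    ; sym   = λ e → mk (sym (cross e))
    ; trans = ≈f-trans
    }
  private module E = IsEquivalence ≈f-isEquivalence

  +f-cong : ∀ {x x′ y y′} → x ≈f x′ → y ≈f y′ → (x +f y) ≈f (x′ +f y′)
  +f-cong {frac a b _} {frac a′ b′ _} {frac c d _} {frac c′ d′ _} (mk p) (mk r) = mk
    (trans (solve 6 (λ a b c d b′ d′ →
              ((a :* d :+ c :* b) :* (b′ :* d′)) := ((a :* b′) :* (d :* d′) :+ (c :* d′) :* (b :* b′)))
              refl a b c d b′ d′)
    (trans (+-cong (*-congʳ p) (*-congʳ r))
      (solve 6 (λ a′ b c′ d b′ d′ →
              ((a′ :* b) :* (d :* d′) :+ (c′ :* d) :* (b :* b′)) := ((a′ :* d′ :+ c′ :* b′) :* (b :* d)))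
              refl a′ b c′ d b′ d′)))

  *f-cong : ∀ {x x′ y y′} → x ≈f x′ → y ≈f y′ → (x *f y) ≈f (x′ *f y′)
  *f-cong {frac a b _} {frac a′ b′ _} {frac c d _} {frac c′ d′ _} (mk p) (mk r) = mk
    (trans (solve 4 (λ a c b′ d′ → ((a :* c) :* (b′ :* d′)) := ((a :* b′) :* (c :* d′))) refl a c b′ d′)
    (trans (*-cong p r)
      (solve 4 (λ a′ c′ b d → ((a′ :* b) :* (c′ :* d)) := ((a′ :* c′) :* (b :* d))) refl a′ c′ b d)))

  -f-cong : ∀ {x y} → x ≈f y → (-f x) ≈f (-f y)
  -f-cong {frac a b _} {frac c d _} (mk p) = mk
    (trans (sym (-‿distribˡ-* a d)) (trans (-‿cong p) (-‿distribˡ-* c b)))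

  +f-assoc : ∀ x y z → ((x +f y) +f z) ≈f (x +f (y +f z))
  +f-assoc (frac a b _) (frac c d _) (frac e f _) = mk (solve 6 (λ a b c d e f →
    (((a :* d :+ c :* b) :* f :+ e :* (b :* d)) :* (b :* (d :* f)))
      := ((a :* (d :* f) :+ (c :* f :+ e :* d) :* b) :* ((b :* d) :* f))) refl a b c d e f)

  +f-comm : ∀ x y → (x +f y) ≈f (y +f x)
  +f-comm (frac a b _) (frac c d _) = mk (solve 4 (λ a b c d →
    ((a :* d :+ c :* b) :* (d :* b)) := ((c :* b :+ a :* d) :* (b :* d))) refl a b c d)

  +f-identityˡ : ∀ x → (embed 0# +f x) ≈f x
  +f-identityˡ (frac a b _) = mk
    (trans (*-congʳ (trans (+-cong (zeroˡ b) (*-identityʳ a)) (+-identityˡ a)))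
      (*-congˡ (sym (*-identityˡ b))))

  +f-inverseˡ : ∀ x → ((-f x) +f x) ≈f embed 0#
  +f-inverseˡ (frac a b _) = mk
    (trans (*-congʳ (trans (sym (distribʳ b (- a) a))
      (trans (*-congʳ (-‿inverseˡ a)) (zeroˡ b))))
    (trans (zeroˡ 1#) (sym (zeroˡ _))))

  *f-assoc : ∀ x y z → ((x *f y) *f z) ≈f (x *f (y *f z))
  *f-assoc (frac a b _) (frac c d _) (frac e f _) = mk (solve 6 (λ a b c d e f →
    (((a :* c) :* e) :* (b :* (d :* f))) := ((a :* (c :* e)) :* ((b :* d) :* f))) refl a b c d e f)

  *f-comm : ∀ x y → (x *f y) ≈f (y *f x)
  *f-comm (frac a b _) (frac c d _) = mk (*-cong (*-comm a c) (*-comm d b))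

  *f-identityˡ : ∀ x → (embed 1# *f x) ≈f x
  *f-identityˡ (frac a b _) = mk (*-cong (*-identityˡ a) (sym (*-identityˡ b)))

  *f-distribˡ : ∀ x y z → (x *f (y +f z)) ≈f ((x *f y) +f (x *f z))
  *f-distribˡ (frac a b _) (frac c d _) (frac e f _) = mk (solve 6 (λ a b c d e f →
    ((a :* (c :* f :+ e :* d)) :* ((b :* d) :* (b :* f)))
      := (((a :* c) :* (b :* f) :+ (a :* e) :* (b :* d)) :* (b :* (d :* f)))) refl a b c d e f)

  fractionRing : CommutativeRing (c ⊔ ℓ) ℓ
  fractionRing = record
    { Carrier = Fraction ; _≈_ = _≈f_ ; _+_ = _+f_ ; _*_ = _*f_ ; -_ = -f_
    ; 0# = embed 0# ; 1# = embed 1#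
    ; isCommutativeRing = record
      { isRing = record
        { +-isAbelianGroup = record
          { isGroup = record
            { isMonoid = record
              { isSemigroup = record
                { isMagma = record { isEquivalence = ≈f-isEquivalence ; ∙-cong = +f-cong }
                ; assoc = +f-assoc
                }
              ; identity = +f-identityˡ ,
                  λ x → E.trans (+f-comm x (embed 0#)) (+f-identityˡ x)
              }
            ; inverse = +f-inverseˡ , λ x → E.trans (+f-comm x (-f x)) (+f-inverseˡ x)
            ; ⁻¹-cong = -f-cong
            }
          ; comm = +f-comm
          }
        ; *-cong = *f-cong
        ; *-assoc = *f-assoc
        ; *-identity = *f-identityˡ ,
            λ x → E.trans (*f-comm x (embed 1#)) (*f-identityˡ x)
        ; distrib = *f-distribˡ , λ x y z → E.trans (*f-comm (y +f z) x)
            (E.trans (*f-distribˡ x y z) (+f-cong (*f-comm x y) (*f-comm x z)))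
        }
      ; *-comm = *f-comm
      }
    }

  embed-cong : ∀ {a b} → a ≈ b → embed a ≈f embed b
  embed-cong e = mk (*-congʳ e)

  embed-* : ∀ a b → embed (a * b) ≈f (embed a *f embed b)
  embed-* a b = mk (*-congˡ (*-identityˡ 1#))

  embed-+ : ∀ a b → embed (a + b) ≈f (embed a +f embed b)
  embed-+ a b = mk (*-cong (sym (+-cong (*-identityʳ a) (*-identityʳ b))) (*-identityˡ 1#))

  embed-neg : ∀ a → embed (- a) ≈f (-f embed a)
  embed-neg a = mk refl

  num-regular⇒invertible : ∀ {x} → Regular R (num x) → Invertible _≈f_ (embed 1#) _*f_ x
  num-regular⇒invertible {frac a b rb} ra =
    frac b a ra , mk (*-one (*-comm b a)) , mk (*-one (*-comm a b))
    where
    *-one : ∀ {u v} → u ≈ v → u * 1# ≈ 1# * v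
    *-one e = trans (*-comm _ _) (*-congˡ e)

-- q-Pochhammer symbols, division and finitely supported sums in a ring F.
module RingOps (F : CommutativeRing c ℓ) where
  open CommutativeRing F public hiding (zero)
  open Algebra.Properties.Semiring.Exp semiring public using (_^_)
  open Algebra.Properties.Monoid.Sum +-monoid public using (sum)

  Inv : Carrier → Set (c ⊔ ℓ)
  Inv = Invertible _≈_ 1# _*_

  infixl 7 _/_[_]
  _/_[_] : Carrier → ∀ y → Inv y → Carrier
  x / y [ y⁻¹ , _ ] = x * y⁻¹

  -- qPoch q x n = (x;q)ₙ
  qPoch : Carrier → Carrier → ℕ → Carrier
  qPoch q x zero    = 1#
  qPoch q x (suc n) = qPoch q x n * (1# - x * q ^ n)

  𝟏 : ∀ {a} {A : Set a} → Dec A → Carrier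
  𝟏 (yes _) = 1#
  𝟏 (no  _) = 0#

  FinitelySupported : (ℕ → ℕ → ℕ → Carrier) → Set ℓ
  FinitelySupported f = ∃[ N ] ∀ l₁ l₂ l₃ →
    N ℕ.≤ l₁ ⊎ N ℕ.≤ l₂ ⊎ N ℕ.≤ l₃ → f l₁ l₂ l₃ ≈ 0#

  -- Σ over ℕ³; the support bound N only determines where to truncate.
  ∑ℕ³ : (f : ℕ → ℕ → ℕ → Carrier) → FinitelySupported f → Carrier
  ∑ℕ³ f (N , _) = sum {N} λ l₁ → sum {N} λ l₂ → sum {N} λ l₃ →
    f (toℕ l₁) (toℕ l₂) (toℕ l₃)

  inv-1 : Inv 1#
  inv-1 = 1# , *-identityˡ 1# , *-identityˡ 1#

  inv-* : ∀ {x y} → Inv x → Inv y → Inv (x * y)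
  inv-* {x} {y} (x′ , x′x≈1 , _) (y′ , y′y≈1 , _) =
    x′ * y′ , e , trans (*-comm _ _) e
    where
    module S = Algebra.Solver.Ring.NaturalCoefficients.Default commutativeSemiring
    open S using (solve; _:=_; _:*_)
    e : (x′ * y′) * (x * y) ≈ 1#
    e = trans (solve 4 (λ a b c d → ((a :* b) :* (c :* d)) := ((a :* c) :* (b :* d))) refl x′ y′ x y)
      (trans (*-cong x′x≈1 y′y≈1) (*-identityˡ 1#))

  inv-resp : ∀ {x y} → x ≈ y → Inv x → Inv y
  inv-resp x≈y (x′ , l , r) =
    x′ , trans (*-congˡ (sym x≈y)) l , trans (*-congʳ (sym x≈y)) r

  inv-^ : ∀ {x} → Inv x → ∀ n → Inv (x ^ n)
  inv-^ ix zero    = inv-1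
  inv-^ ix (suc n) = inv-* ix (inv-^ ix n)

  inv-qPoch : ∀ {q x} → (∀ n → Inv (1# - x * q ^ n)) → ∀ n → Inv (qPoch q x n)
  inv-qPoch h zero    = inv-1
  inv-qPoch h (suc n) = inv-* (inv-qPoch h n) (h n)

module Weight (F : CommutativeRing c ℓ) (q : CommutativeRing.Carrier F)
              (q-inv : ∀ n → RingOps.Inv F (RingOps.qPoch F q q n)) where
  open RingOps F

  infix 8 ⟨_⟩_
  ⟨_⟩_ : Carrier → ℕ → Carrier
  ⟨ x ⟩ n = qPoch q x n

  -- The parameters (t,s) for which no denominator of the weight vanishes.
  record Admissible (t s : Carrier) : Set (c ⊔ ℓ) where
    field
      t-inv  : Inv t
      s²-inv : ∀ n → Inv (⟨ s ^ 2 ⟩ n)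

  -- W t s _ i j k l is the weight W^s_{t,s}(i,j;k,l).
  W : (t s : Carrier) → Admissible t s → (i j k l : ℕ) → Carrier
  W t s adm i j k l =
    𝟏 (i ℕ.+ j ℕₚ.≟ k ℕ.+ l) * 𝟏 (l ℕₚ.≤? i)
      * (s ^ (2 ℕ.* l) / t ^ (2 ℕ.* l) [ inv-^ t-inv (2 ℕ.* l) ])
      * ((⟨ s ^ 2 / t ^ 2 [ inv-^ t-inv 2 ] ⟩ (i ∸ l) * ⟨ t ^ 2 ⟩ l)
          / ⟨ s ^ 2 ⟩ i [ s²-inv i ])
      * (⟨ q ⟩ i / ⟨ q ⟩ (i ∸ l) * ⟨ q ⟩ l [ inv-* (q-inv (i ∸ l)) (q-inv l) ])
    where open Admissible adm

  W-vanishes : ∀ t s adm i j k l → ¬ (i ℕ.+ j ≡ k ℕ.+ l) → W t s adm i j k l ≈ 0#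
  W-vanishes t s adm i j k l i+j≢k+l with i ℕ.+ j ℕₚ.≟ k ℕ.+ l
  ... | yes e = contradiction e i+j≢k+l
  ... | no  _ = 0*⁴ _ _ _ _
    where
    0*⁴ : ∀ a b d e → 0# * a * b * d * e ≈ 0#
    0*⁴ a b d e =
      trans (*-congʳ (trans (*-congʳ (trans (*-congʳ (zeroˡ a)) (zeroˡ b))) (zeroˡ d))) (zeroˡ e)

  -- In each sum at least one weight in every term vanishes by conservation
  -- i+j=k+l as soon as some lᵢ exceeds a₁+a₂+a₃.
  module Support (a₁ a₂ a₃ b₁ b₂ b₃ : ℕ) where
    private
      A = a₁ ℕ.+ a₂ ℕ.+ a₃

      vanish₃ : ∀ {x y z} → (x ≈ 0#) ⊎ (y ≈ 0#) ⊎ (z ≈ 0#) → x * y * z ≈ 0#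
      vanish₃ (inj₁ e)        = trans (*-congʳ (trans (*-congʳ e) (zeroˡ _))) (zeroˡ _)
      vanish₃ (inj₂ (inj₁ e)) = trans (*-congʳ (trans (*-congˡ e) (zeroʳ _))) (zeroˡ _)
      vanish₃ (inj₂ (inj₂ e)) = trans (*-congˡ e) (zeroʳ _)

      open ℕₚ.≤-Reasoning

      a₃+a₂≤A : a₃ ℕ.+ a₂ ℕ.≤ A
      a₃+a₂≤A = begin
        a₃ ℕ.+ a₂          ≡⟨ ℕₚ.+-comm a₃ a₂ ⟩
        a₂ ℕ.+ a₃          ≤⟨ ℕₚ.m≤n+m _ a₁ ⟩
        a₁ ℕ.+ (a₂ ℕ.+ a₃) ≡⟨ ℕₚ.+-assoc a₁ a₂ a₃ ⟨
        A                  ∎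

      A≡ : a₃ ℕ.+ (a₂ ℕ.+ a₁) ≡ A
      A≡ = ≡.trans (ℕₚ.+-comm a₃ _) (≡.cong (ℕ._+ a₃) (ℕₚ.+-comm a₂ a₁))

      impossible : ∀ {l₁ l₂ l₃} → l₁ ℕ.≤ A → l₂ ℕ.≤ A → l₃ ℕ.≤ A →
        ¬ (suc A ℕ.≤ l₁ ⊎ suc A ℕ.≤ l₂ ⊎ suc A ℕ.≤ l₃)
      impossible p _ _ (inj₁ r)        = ℕₚ.<⇒≱ r p
      impossible _ p _ (inj₂ (inj₁ r)) = ℕₚ.<⇒≱ r p
      impossible _ _ p (inj₂ (inj₂ r)) = ℕₚ.<⇒≱ r p

    lhs-finite : ∀ {t s t′ s′ t″ s″} u v w → FinitelySupported λ l₁ l₂ l₃ →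
      W t s u a₃ a₂ l₃ l₂ * W t′ s′ v l₃ a₁ b₃ l₁ * W t″ s″ w l₂ l₁ b₂ b₁
    lhs-finite {t} {s} {t′} {s′} u v w = suc A , vanishes
      where
      vanishes : ∀ l₁ l₂ l₃ → _ → _
      vanishes l₁ l₂ l₃ large
        with a₃ ℕ.+ a₂ ℕₚ.≟ l₃ ℕ.+ l₂ | l₃ ℕ.+ a₁ ℕₚ.≟ b₃ ℕ.+ l₁
      ... | no ≢  | _     = vanish₃ (inj₁ (W-vanishes t s u a₃ a₂ l₃ l₂ ≢))
      ... | yes _ | no ≢  = vanish₃ (inj₂ (inj₁ (W-vanishes t′ s′ v l₃ a₁ b₃ l₁ ≢)))
      ... | yes e | yes f = contradiction large (impossible
        (begin
          l₁                        ≤⟨ ℕₚ.m≤n+m l₁ b₃ ⟩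
          b₃ ℕ.+ l₁                 ≡⟨ f ⟨
          l₃ ℕ.+ a₁                 ≤⟨ ℕₚ.+-monoˡ-≤ a₁ (ℕₚ.m≤m+n l₃ l₂) ⟩
          l₃ ℕ.+ l₂ ℕ.+ a₁          ≡⟨ ≡.cong (ℕ._+ a₁) e ⟨
          a₃ ℕ.+ a₂ ℕ.+ a₁          ≡⟨ ℕₚ.+-assoc a₃ a₂ a₁ ⟩
          a₃ ℕ.+ (a₂ ℕ.+ a₁)        ≡⟨ A≡ ⟩
          A                         ∎)
        (begin
          l₂                        ≤⟨ ℕₚ.m≤n+m l₂ l₃ ⟩
          l₃ ℕ.+ l₂                 ≡⟨ e ⟨
          a₃ ℕ.+ a₂                 ≤⟨ a₃+a₂≤A ⟩
          A                         ∎)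
        (begin
          l₃                        ≤⟨ ℕₚ.m≤m+n l₃ l₂ ⟩
          l₃ ℕ.+ l₂                 ≡⟨ e ⟨
          a₃ ℕ.+ a₂                 ≤⟨ a₃+a₂≤A ⟩
          A                         ∎))

    rhs-finite : ∀ {t s t′ s′ t″ s″} u v w → FinitelySupported λ l₁ l₂ l₃ →
      W t s u a₂ a₁ l₂ l₁ * W t′ s′ v a₃ l₁ l₃ b₁ * W t″ s″ w l₃ l₂ b₃ b₂
    rhs-finite {t} {s} {t′} {s′} u v w = suc A , vanishes
      where
      a₂+a₁≤A : a₂ ℕ.+ a₁ ℕ.≤ A
      a₂+a₁≤A = begin
        a₂ ℕ.+ a₁          ≤⟨ ℕₚ.m≤n+m _ a₃ ⟩
        a₃ ℕ.+ (a₂ ℕ.+ a₁) ≡⟨ A≡ ⟩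
        A                  ∎
      vanishes : ∀ l₁ l₂ l₃ → _ → _
      vanishes l₁ l₂ l₃ large
        with a₂ ℕ.+ a₁ ℕₚ.≟ l₂ ℕ.+ l₁ | a₃ ℕ.+ l₁ ℕₚ.≟ l₃ ℕ.+ b₁
      ... | no ≢  | _     = vanish₃ (inj₁ (W-vanishes t s u a₂ a₁ l₂ l₁ ≢))
      ... | yes _ | no ≢  = vanish₃ (inj₂ (inj₁ (W-vanishes t′ s′ v a₃ l₁ l₃ b₁ ≢)))
      ... | yes e | yes f = contradiction large (impossible
        (begin
          l₁                        ≤⟨ ℕₚ.m≤n+m l₁ l₂ ⟩
          l₂ ℕ.+ l₁                 ≡⟨ e ⟨
          a₂ ℕ.+ a₁                 ≤⟨ a₂+a₁≤A ⟩
          A                         ∎)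
        (begin
          l₂                        ≤⟨ ℕₚ.m≤m+n l₂ l₁ ⟩
          l₂ ℕ.+ l₁                 ≡⟨ e ⟨
          a₂ ℕ.+ a₁                 ≤⟨ a₂+a₁≤A ⟩
          A                         ∎)
        (begin
          l₃                        ≤⟨ ℕₚ.m≤m+n l₃ b₁ ⟩
          l₃ ℕ.+ b₁                 ≡⟨ f ⟨
          a₃ ℕ.+ l₁                 ≤⟨ ℕₚ.+-monoʳ-≤ a₃ (ℕₚ.m≤n+m l₁ l₂) ⟩
          a₃ ℕ.+ (l₂ ℕ.+ l₁)        ≡⟨ ≡.cong (a₃ ℕ.+_) e ⟨
          a₃ ℕ.+ (a₂ ℕ.+ a₁)        ≡⟨ A≡ ⟩
          A                         ∎))

-- q is neither zero nor a root of unity.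
record Generic (K : HeytingField c ℓ ℓ₂)
               (q : HeytingField.Carrier K) : Set ℓ₂ where
  open HeytingField K
  open RingOps (HeytingCommutativeRing.commutativeRing heytingCommutativeRing) using (_^_)
  field
    nonzero        : q # 0#
    no-root-of-one : ∀ n → 1# # q ^ suc n

-- The field K(x₀,…,xₙ₋₁) of rational functions.
module RationalFunctionField (K : HeytingField c ℓ ℓ₂) (n : ℕ) where
  baseRing : CommutativeRing c ℓ
  baseRing = HeytingCommutativeRing.commutativeRing (HeytingField.heytingCommutativeRing K)

  open Multivariate baseRing
  private module F = FractionRing (MvPoly n)

  rationalFunctions : CommutativeRing (c ⊔ ℓ) ℓ
  rationalFunctions = F.fractionRing

  open RingOps rationalFunctions

  fromBase : HeytingField.Carrier K → Carrier
  fromBase a = F.embed (const n a)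

  indeterminate : Fin n → Carrier
  indeterminate i = F.embed (var i)

  module Weights (q₀ : HeytingField.Carrier K) (generic : Generic K q₀) where
    private
      module B = RingOps baseRing
      module P = RingOps (MvPoly n)
      module K = HeytingField K
    open Generic generic

    q : Carrier
    q = fromBase q₀

    private
      IsPoly : Carrier → P.Carrier → Set ℓ
      IsPoly y x = y ≈ F.embed x

      poly-* : ∀ {y z x w} → IsPoly y x → IsPoly z w → IsPoly (y * z) (x P.* w)
      poly-* e f = trans (*-cong e f) (sym (F.embed-* _ _))

      poly-^ : ∀ {y x} → IsPoly y x → ∀ m → IsPoly (y ^ m) (x P.^ m)
      poly-^ e zero    = refl
      poly-^ {y} e (suc m) = poly-* {y} {y ^ m} e (poly-^ {y} e m)

      constantTerm-^ : ∀ x m → constantTerm n (x P.^ m) B.≈ constantTerm n x B.^ m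
      constantTerm-^ x zero    = constantTerm-1 n
      constantTerm-^ x (suc m) =
        B.trans (constantTerm-* n x (x P.^ m)) (B.*-congˡ (constantTerm-^ x m))

      factor-inv : ∀ {y x a} m → IsPoly y x → constantTerm n x B.≈ a →
        B.Inv (B.1# B.- a B.* q₀ B.^ m) → Inv (1# - y * q ^ m)
      factor-inv {y} {x} {a} m y≈x x₀≈a inv = inv-resp {F.embed p} {1# - y * q ^ m} (sym isPoly)
        (F.num-regular⇒invertible {F.embed p} (constantTerm-regular n _
          (RegularProperties.invertible⇒regular baseRing (B.inv-resp (B.sym constantTerm≈) inv))))
        where
        Q = const n q₀
        p = P.1# P.- x P.* Q P.^ m
        isPoly-neg : IsPoly (- (y * q ^ m)) (P.- (x P.* Q P.^ m))
        isPoly-neg = trans { - (y * q ^ m)} { - F.embed (x P.* Q P.^ m)}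
          (-‿cong {y * q ^ m} {F.embed (x P.* Q P.^ m)}
            (poly-* {y} {q ^ m} y≈x (poly-^ {q} {Q} refl m)))
          (sym {F.embed (P.- (x P.* Q P.^ m))} (F.embed-neg _))
        isPoly : IsPoly (1# - y * q ^ m) p
        isPoly = trans {1# - y * q ^ m} {F.embed P.1# + F.embed (P.- (x P.* Q P.^ m))}
          (+-congˡ {1#} { - (y * q ^ m)} isPoly-neg)
          (sym {F.embed p} (F.embed-+ _ _))
        constantTerm≈ :
          constantTerm n p B.≈ B.1# B.- a B.* q₀ B.^ m
        constantTerm≈ = B.trans (constantTerm-+ n P.1# _) (B.+-cong (constantTerm-1 n)
          (B.trans (constantTerm-neg n _) (B.-‿cong
          (B.trans (constantTerm-* n x _) (B.*-cong x₀≈a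
          (B.trans (constantTerm-^ Q m) (pow m)))))))
          where
          pow : ∀ m → constantTerm n Q B.^ m B.≈ q₀ B.^ m
          pow zero    = B.refl
          pow (suc m) = B.*-cong (constantTerm-const n q₀) (pow m)

    qPoch-inv : ∀ m → Inv (qPoch q q m)
    qPoch-inv = inv-qPoch λ m → factor-inv {x = const n q₀} m refl
      (constantTerm-const n q₀) (K.#⇒invertible (no-root-of-one m))

    open Weight rationalFunctions q qPoch-inv public

    private
      admissible : ∀ {t s x y} → IsPoly t x → Regular (MvPoly n) x →
        IsPoly s y → constantTerm n y B.≈ B.0# → Admissible t s
      admissible {t} {s} {x} {y} t≈x rx s≈y y₀≈0 = record
        { t-inv  = inv-resp {F.embed x} {t} (sym {t} t≈x) (F.num-regular⇒invertible {F.embed x} rx)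
        ; s²-inv = inv-qPoch λ m → factor-inv m (poly-^ {s} {y} s≈y 2)
            (B.trans (constantTerm-* n y _) (B.trans (B.*-congʳ y₀≈0) (B.zeroˡ _)))
            (inv-resp′ m)
        }
        where
        inv-resp′ : ∀ m → B.Inv (B.1# B.- B.0# B.* q₀ B.^ m)
        inv-resp′ m = B.inv-resp (B.sym (B.trans
          (B.+-congˡ (B.trans (B.-‿cong (B.zeroˡ _)) -0#≈0#)) (B.+-identityʳ _))) B.inv-1
          where open Algebra.Properties.Ring B.ring using (-0#≈0#)

    var-admissible : ∀ i j → Admissible (indeterminate i) (indeterminate j)
    var-admissible i j =
      admissible {x = var i} {y = var j} refl (var-regular n i) refl (constantTerm-var n j)

    var*var-admissible : ∀ k i j → Admissible
      (indeterminate k * indeterminate i) (indeterminate k * indeterminate j)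
    var*var-admissible k i j = admissible {x = var k P.* var i} {y = var k P.* var j}
      (sym (F.embed-* _ _))
      (RegularProperties.regular-* (MvPoly n) (var-regular n k) (var-regular n i))
      (sym (F.embed-* _ _))
      (B.trans (constantTerm-* n (var k) (var j))
        (B.trans (B.*-congˡ (constantTerm-var n j)) (B.zeroʳ _)))

-- The four indeterminates of K(η,t₁,t₂,t₃), with the admissible pairs.
module RationalFunctions (K : HeytingField c ℓ ℓ₂) where
  open RationalFunctionField K 4 public

  private
    module R = RingOps rationalFunctions

  η t₁ t₂ t₃ : R.Carrier
  η  = indeterminate 0F
  t₁ = indeterminate 1F
  t₂ = indeterminate 2F
  t₃ = indeterminate 3F

  module Parameters (q₀ : HeytingField.Carrier K) (generic : Generic K q₀) where
    open Weights q₀ generic public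

    t₁-t₂ : Admissible t₁ t₂
    t₁-t₂ = var-admissible 1F 2F
    t₁-t₃ : Admissible t₁ t₃
    t₁-t₃ = var-admissible 1F 3F
    t₂-t₃ : Admissible t₂ t₃
    t₂-t₃ = var-admissible 2F 3F
    ηt₁-ηt₂ : Admissible (η R.* t₁) (η R.* t₂)
    ηt₁-ηt₂ = var*var-admissible 0F 1F 2F
    ηt₁-ηt₃ : Admissible (η R.* t₁) (η R.* t₃)
    ηt₁-ηt₃ = var*var-admissible 0F 1F 3F
    ηt₂-ηt₃ : Admissible (η R.* t₂) (η R.* t₃)
    ηt₂-ηt₃ = var*var-admissible 0F 2F 3F

{-# OPTIONS --safe #-}
module Submission where

-- The weight W^s_{t,s}(i,j;k,l) is the q-Hahn probability of l given i, with
-- parameters μ = s²/t² and u = t². Writing q-Hahn means as q-binomial sums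
-- Σ_{r+s=n} [n;r]_q f r s, the q-Chu–Vandermonde identity shows that they act
-- diagonally on the functions b ↦ [b;k]_q, and these span all functions of b
-- by q-binomial inversion. On the left-hand side the arrow b₁ splits off by
-- [a₃;l₂][l₂;b₁] = [a₃;b₁][a₃-b₁;l₂-b₁], which removes η and leaves an exchange
-- relation for two-step q-Hahn means. Tested on b ↦ [b;k]_q and expanded by
-- q-Vandermonde, that relation reduces coefficientwise to the q-Saalschütz sum.

open import Defs
open import Level using (Level)
open import Algebra.Bundles using (CommutativeRing; RawRing)
open import Algebra.Apartness.Bundles using (HeytingField)
open import Algebra.Solver.Ring.AlmostCommutativeRing
  using (fromCommutativeRing; _-Raw-AlmostCommutative⟶_)
import Algebra.Solver.Ring
import Algebra.Properties.AbelianGroup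
import Algebra.Properties.Ring
import Algebra.Properties.CommutativeMonoid.Sum
import Algebra.Properties.CommutativeSemiring.Exp
import Algebra.Properties.Semiring.Sum
import Algebra.Properties.Semiring.Mult.TCOptimised
import Algebra.Solver.Ring.NaturalCoefficients.Default
open import Data.Fin.Base using (toℕ)
open import Data.Maybe.Base using (Maybe; just; nothing)
open import Data.Nat.Base as ℕ using (ℕ; zero; suc)
import Data.Nat.Properties as ℕₚ
open import Data.Nat.Solver using (module +-*-Solver)
open import Data.Product.Base using (_×_; _,_; proj₁; proj₂)
open import Relation.Binary.PropositionalEquality as ≡ using (_≡_)
open import Relation.Nullary.Decidable.Core using (Dec; yes; no)
open import Relation.Nullary.Negation using (¬_; contradiction)
import Relation.Binary.Reasoning.Setoid
open +-*-Solver using () renaming (solve to ℕ-solve; _:+_ to _ℕ:+_; _:=_ to _ℕ:=_)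

-- Write [n;r] for the q-binomial coefficient. None is ever formed as a quotient: a sum weighted by
-- [n;r] is defined by iterating the q-Pascal rule on its summand, so that symmetry, associativity
-- and q-Vandermonde are inductions on n with the summand left general and nothing is divided by
-- (q;q)_n. The quotient of q-factorials in W is met once, when a weight is rewritten as such a sum.
-- All other denominators enter as given sequences of reciprocals. The parameters are x = t₁², ρ =
-- t₂²/t₁², μ = t₃²/t₂² and y = η²t₁². The obstacle is that the exchange relation evaluates
-- functions at shifted arguments such as m + b, and a shift is not diagonal on b ↦ [b;k]. Without
-- the shift the relation would be the product rule c₁₃ = c₁₂c₂₃ for the eigenvalues of the three
-- means; the q-Saalschütz sum is the form which that rule takes once the shift mixes eigenvalues.
-- The factor (μρ;q)_n carried by the exchange relation is exactly what the weight for (ηt₁,ηt₃)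
-- needs as a numerator; this is how that weight emerges from the left-hand side.

private
  variable
    c ℓ : Level

-- A ring solver with integer coefficients, for identities in the factors 1 - x q^n.

module IntegerCoefficients (R : CommutativeRing c ℓ) where
  open CommutativeRing R
  open Algebra.Properties.Ring ring using (-‿distribˡ-*; -‿distribʳ-*; -0#≈0#)
  open Algebra.Properties.AbelianGroup +-abelianGroup
    using (⁻¹-∙-comm; ⁻¹-involutive; ⁻¹-anti-homo‿-)
  open Algebra.Properties.Semiring.Mult.TCOptimised semiring
    using (×-homo-+; ×1-homo-*) renaming (_×_ to _⋆_)
  open Relation.Binary.Reasoning.Setoid setoid
  private
    module S = Algebra.Solver.Ring.NaturalCoefficients.Default commutativeSemiring
    open S using (solve; _:=_; _:+_; _:*_)

    -- The pair (m , n) stands for the integer m - n.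
    differences : RawRing _ _
    differences = record
      { Carrier = ℕ × ℕ
      ; _≈_ = λ (a , b) (c , d) → a ℕ.+ d ≡ c ℕ.+ b
      ; _+_ = λ (a , b) (c , d) → a ℕ.+ c , b ℕ.+ d
      ; _*_ = λ (a , b) (c , d) → a ℕ.* c ℕ.+ b ℕ.* d , a ℕ.* d ℕ.+ b ℕ.* c
      ; -_ = λ (a , b) → b , a
      ; 0# = 0 , 0
      ; 1# = 1 , 0
      }

    ⌊_⌋ : ℕ → Carrier
    ⌊ n ⌋ = n ⋆ 1#

    -- The case split makes ⟦ 1 , 0 ⟧ reduce to 1#.
    ⟦_⟧ : ℕ × ℕ → Carrier
    ⟦ a , zero  ⟧ = ⌊ a ⌋
    ⟦ a , suc b ⟧ = ⌊ a ⌋ - ⌊ suc b ⌋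

    ⟦⟧-difference : ∀ a b → ⟦ a , b ⟧ ≈ ⌊ a ⌋ - ⌊ b ⌋
    ⟦⟧-difference a zero    = sym (trans (+-congˡ -0#≈0#) (+-identityʳ _))
    ⟦⟧-difference a (suc b) = refl

    interchange : ∀ x y z w → (x + y) + (z + w) ≈ (x + z) + (y + w)
    interchange = solve 4 (λ x y z w → (x :+ y) :+ (z :+ w) := (x :+ z) :+ (y :+ w)) refl

    +-homo : ∀ x y → ⟦ RawRing._+_ differences x y ⟧ ≈ ⟦ x ⟧ + ⟦ y ⟧
    +-homo (a , b) (c , d) = begin
      ⟦ a ℕ.+ c , b ℕ.+ d ⟧                      ≈⟨ ⟦⟧-difference (a ℕ.+ c) (b ℕ.+ d) ⟩
      ⌊ a ℕ.+ c ⌋ - ⌊ b ℕ.+ d ⌋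
        ≈⟨ +-cong (×-homo-+ 1# a c) (-‿cong (×-homo-+ 1# b d)) ⟩
      (⌊ a ⌋ + ⌊ c ⌋) - (⌊ b ⌋ + ⌊ d ⌋)          ≈⟨ +-congˡ (⁻¹-∙-comm _ _) ⟨
      (⌊ a ⌋ + ⌊ c ⌋) + (- ⌊ b ⌋ + - ⌊ d ⌋)      ≈⟨ interchange _ _ _ _ ⟩
      (⌊ a ⌋ - ⌊ b ⌋) + (⌊ c ⌋ - ⌊ d ⌋)
        ≈⟨ +-cong (⟦⟧-difference a b) (⟦⟧-difference c d) ⟨
      ⟦ a , b ⟧ + ⟦ c , d ⟧                      ∎

    -‿homo : ∀ x → ⟦ RawRing.-_ differences x ⟧ ≈ - ⟦ x ⟧
    -‿homo (a , b) = begin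
      ⟦ b , a ⟧           ≈⟨ ⟦⟧-difference b a ⟩
      ⌊ b ⌋ - ⌊ a ⌋       ≈⟨ ⁻¹-anti-homo‿- _ _ ⟨
      - (⌊ a ⌋ - ⌊ b ⌋)   ≈⟨ -‿cong (⟦⟧-difference a b) ⟨
      - ⟦ a , b ⟧         ∎

    *-homo : ∀ x y → ⟦ RawRing._*_ differences x y ⟧ ≈ ⟦ x ⟧ * ⟦ y ⟧
    *-homo (a , b) (c , d) = begin
      ⟦ a ℕ.* c ℕ.+ b ℕ.* d , a ℕ.* d ℕ.+ b ℕ.* c ⟧
        ≈⟨ ⟦⟧-difference (a ℕ.* c ℕ.+ b ℕ.* d) (a ℕ.* d ℕ.+ b ℕ.* c) ⟩
      ⌊ a ℕ.* c ℕ.+ b ℕ.* d ⌋ - ⌊ a ℕ.* d ℕ.+ b ℕ.* c ⌋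
        ≈⟨ +-cong (expand a c b d) (-‿cong (expand a d b c)) ⟩
      (⌊ a ⌋ * ⌊ c ⌋ + ⌊ b ⌋ * ⌊ d ⌋) - (⌊ a ⌋ * ⌊ d ⌋ + ⌊ b ⌋ * ⌊ c ⌋)
        ≈⟨ +-cong (+-congˡ double-negation) (sym (⁻¹-∙-comm _ _)) ⟩
      (⌊ a ⌋ * ⌊ c ⌋ + - ⌊ b ⌋ * - ⌊ d ⌋) + (- (⌊ a ⌋ * ⌊ d ⌋) + - (⌊ b ⌋ * ⌊ c ⌋))
        ≈⟨ +-congˡ (+-cong (-‿distribʳ-* _ _) (-‿distribˡ-* _ _)) ⟩
      (⌊ a ⌋ * ⌊ c ⌋ + - ⌊ b ⌋ * - ⌊ d ⌋) + (⌊ a ⌋ * - ⌊ d ⌋ + - ⌊ b ⌋ * ⌊ c ⌋)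
        ≈⟨ solve 4 (λ a b c d → (a :* c :+ b :* d) :+ (a :* d :+ b :* c)
             := (a :+ b) :* (c :+ d)) refl ⌊ a ⌋ (- ⌊ b ⌋) ⌊ c ⌋ (- ⌊ d ⌋) ⟩
      (⌊ a ⌋ - ⌊ b ⌋) * (⌊ c ⌋ - ⌊ d ⌋)
        ≈⟨ *-cong (⟦⟧-difference a b) (⟦⟧-difference c d) ⟨
      ⟦ a , b ⟧ * ⟦ c , d ⟧  ∎
      where
      expand : ∀ a c b d → ⌊ a ℕ.* c ℕ.+ b ℕ.* d ⌋ ≈ ⌊ a ⌋ * ⌊ c ⌋ + ⌊ b ⌋ * ⌊ d ⌋
      expand a c b d = trans (×-homo-+ 1# (a ℕ.* c) (b ℕ.* d)) (+-cong (×1-homo-* a c) (×1-homo-* b d))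
      double-negation : ⌊ b ⌋ * ⌊ d ⌋ ≈ - ⌊ b ⌋ * - ⌊ d ⌋
      double-negation = begin
        ⌊ b ⌋ * ⌊ d ⌋         ≈⟨ ⁻¹-involutive _ ⟨
        - - (⌊ b ⌋ * ⌊ d ⌋)   ≈⟨ -‿cong (-‿distribʳ-* _ _) ⟩
        - (⌊ b ⌋ * - ⌊ d ⌋)   ≈⟨ -‿distribˡ-* _ _ ⟩
        - ⌊ b ⌋ * - ⌊ d ⌋     ∎

    morphism : differences -Raw-AlmostCommutative⟶ fromCommutativeRing R
    morphism = record
      { ⟦_⟧ = ⟦_⟧ ; +-homo = +-homo ; *-homo = *-homo ; -‿homo = -‿homo
      ; 0-homo = refl ; 1-homo = refl }

    ⟦⟧-cong : ∀ a b c d → a ℕ.+ d ≡ c ℕ.+ b → ⟦ a , b ⟧ ≈ ⟦ c , d ⟧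
    ⟦⟧-cong a b c d e = begin
      ⟦ a , b ⟧                            ≈⟨ cancel a b d ⟨
      ⟦ a ℕ.+ d , b ℕ.+ d ⟧
        ≡⟨ ≡.cong₂ (λ m n → ⟦ m , n ⟧) e (ℕₚ.+-comm b d) ⟩
      ⟦ c ℕ.+ b , d ℕ.+ b ⟧                ≈⟨ cancel c d b ⟩
      ⟦ c , d ⟧                            ∎
      where
      cancel : ∀ a b d → ⟦ a ℕ.+ d , b ℕ.+ d ⟧ ≈ ⟦ a , b ⟧
      cancel a b d = trans (+-homo (a , b) (d , d))
        (trans (+-congˡ (trans (⟦⟧-difference d d) (-‿inverseʳ _))) (+-identityʳ _))

    -- Pairs are not normalised, so one integer has many pairs; comparing them by cross addition
    -- lets the solver see that coefficients cancel.
    decide : ∀ x y → Maybe (⟦ x ⟧ ≈ ⟦ y ⟧)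
    decide (a , b) (c , d) with a ℕ.+ d ℕₚ.≟ c ℕ.+ b
    ... | yes e = just (⟦⟧-cong a b c d e)
    ... | no  _ = nothing

  open Algebra.Solver.Ring differences (fromCommutativeRing R) morphism decide public
    hiding (⟦_⟧)

  :0 :1 : ∀ {n} → Polynomial n
  :0 = con (0 , 0)
  :1 = con (1 , 0)

-- Calculus of q-binomial sums and the q-Chu-Vandermonde formula.

module QBinomialSum (R : CommutativeRing c ℓ) (q : CommutativeRing.Carrier R) where
  open RingOps R
  open Algebra.Properties.CommutativeSemiring.Exp commutativeSemiring
    using (^-homo-*; ^-distrib-*)
  open Algebra.Properties.AbelianGroup +-abelianGroup using () renaming (∙-cancelʳ to +-cancelʳ)
  open Relation.Binary.Reasoning.Setoid setoid
  open IntegerCoefficients R using (solve; _:=_; _:+_; _:*_; _:-_; :1; :0)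

  -- Σ_{r+s=n} [n;r]_q f r s, unfolded by [n+1;r] = [n;r-1] + q^r [n;r].
  qsum : ℕ → (ℕ → ℕ → Carrier) → Carrier
  qsum zero    f = f 0 0
  qsum (suc n) f = qsum n λ r s → f (suc r) s + q ^ r * f r (suc s)

  qsum-cong-∣ : ∀ n {f g} → (∀ r s → r ℕ.+ s ≡ n → f r s ≈ g r s) → qsum n f ≈ qsum n g
  qsum-cong-∣ zero    e = e 0 0 ≡.refl
  qsum-cong-∣ (suc n) e = qsum-cong-∣ n λ r s r+s≡n → +-cong (e (suc r) s (≡.cong suc r+s≡n))
    (*-congˡ (e r (suc s) (≡.trans (ℕₚ.+-suc r s) (≡.cong suc r+s≡n))))

  qsum-cong : ∀ n {f g} → (∀ r s → f r s ≈ g r s) → qsum n f ≈ qsum n g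
  qsum-cong n e = qsum-cong-∣ n λ r s _ → e r s

  qsum-+ : ∀ n f g → qsum n (λ r s → f r s + g r s) ≈ qsum n f + qsum n g
  qsum-+ zero    f g = refl
  qsum-+ (suc n) f g = trans
    (qsum-cong n λ r s → solve 5 (λ a b c d e → a :+ b :+ c :* (d :+ e) := a :+ c :* d :+ (b :+ c :* e))
      refl (f (suc r) s) (g (suc r) s) (q ^ r) (f r (suc s)) (g r (suc s)))
    (qsum-+ n _ _)

  *-qsum : ∀ n x f → x * qsum n f ≈ qsum n (λ r s → x * f r s)
  *-qsum zero    x f = refl
  *-qsum (suc n) x f = trans (*-qsum n x _)
    (qsum-cong n λ r s → solve 4 (λ x a b c → x :* (a :+ b :* c) := x :* a :+ b :* (x :* c))
      refl x (f (suc r) s) (q ^ r) (f r (suc s)))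

  qsum-0 : ∀ n → qsum n (λ _ _ → 0#) ≈ 0#
  qsum-0 n = trans (qsum-cong n λ _ _ → sym (zeroˡ 0#)) (trans (sym (*-qsum n _ _)) (zeroˡ _))

  qsum-comm : ∀ m n (f : ℕ → ℕ → ℕ → ℕ → Carrier) →
    qsum m (λ r s → qsum n (f r s)) ≈ qsum n (λ r′ s′ → qsum m λ r s → f r s r′ s′)
  qsum-comm zero    n f = refl
  qsum-comm (suc m) n f = trans
    (qsum-cong m λ r s → trans (+-congˡ (*-qsum n (q ^ r) _)) (sym (qsum-+ n _ _)))
    (qsum-comm m n _)

  -- The other q-Pascal rule, [n+1;r] = q^(n+1-r) [n;r-1] + [n;r]. Played against the defining rule
  -- it yields symmetry and the telescoping behind the q-Saalschütz sum.
  qsum-suc′ : ∀ n f → qsum (suc n) f ≈ qsum n (λ r s → q ^ s * f (suc r) s + f r (suc s))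
  qsum-suc′ zero    f = solve 2 (λ a b → a :+ :1 :* b := :1 :* a :+ b) refl (f 1 0) (f 0 1)
  qsum-suc′ (suc n) f = trans (qsum-suc′ n (λ r s → f (suc r) s + q ^ r * f r (suc s))) (qsum-cong n λ r s →
    solve 6 (λ q Q T a b d → T :* (a :+ (q :* Q) :* b) :+ (b :+ Q :* d)
        := T :* a :+ b :+ Q :* ((q :* T) :* b :+ d))
      refl q (q ^ r) (q ^ s) (f (suc (suc r)) s) (f (suc r) (suc s)) (f r (suc (suc s))))

  qsum-swap : ∀ n f → qsum n f ≈ qsum n (λ r s → f s r)
  qsum-swap zero    f = refl
  qsum-swap (suc n) f = begin
    qsum n (λ r s → f (suc r) s + q ^ r * f r (suc s))  ≈⟨ qsum-swap n _ ⟩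
    qsum n (λ r s → f (suc s) r + q ^ s * f s (suc r))  ≈⟨ qsum-cong n (λ r s → +-comm _ _) ⟩
    qsum n (λ r s → q ^ s * f s (suc r) + f (suc s) r)  ≈⟨ qsum-suc′ n (λ r s → f s r) ⟨
    qsum (suc n) (λ r s → f s r)                        ∎

  -- [n;l][l;r] = [n;r][n-r;l-r]
  qsum-assoc : ∀ n (f : ℕ → ℕ → ℕ → Carrier) →
    qsum n (λ l s → qsum l λ r t → f r t s) ≈ qsum n (λ r u → qsum u λ t s → f r t s)
  qsum-assoc zero    f = refl
  qsum-assoc (suc n) f = begin
    qsum n (λ l s → qsum l (λ r t → f (suc r) t s + q ^ r * f r (suc t) s)
                  + q ^ l * qsum l (λ r t → f r t (suc s)))
      ≈⟨ qsum-cong n (λ l s → trans (+-congˡ (*-qsum l _ _)) (sym (qsum-+ l _ _))) ⟩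
    qsum n (λ l s → qsum l λ r t →
      f (suc r) t s + q ^ r * f r (suc t) s + q ^ l * f r t (suc s))
      ≈⟨ qsum-cong n (λ l s → qsum-cong-∣ l λ r t r+t≡l → trans
           (+-congˡ (*-congʳ (trans (reflexive (≡.cong (q ^_) (≡.sym r+t≡l))) (^-homo-* q r t))))
           (solve 5 (λ a Q b T d → a :+ Q :* b :+ Q :* T :* d := a :+ Q :* (b :+ T :* d)) refl
             (f (suc r) t s) (q ^ r) (f r (suc t) s) (q ^ t) (f r t (suc s)))) ⟩
    qsum n (λ l s → qsum l λ r t →
      f (suc r) t s + q ^ r * (f r (suc t) s + q ^ t * f r t (suc s)))
      ≈⟨ qsum-assoc n _ ⟩
    qsum n (λ r u → qsum u λ t s →
      f (suc r) t s + q ^ r * (f r (suc t) s + q ^ t * f r t (suc s)))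
      ≈⟨ qsum-cong n (λ r u → trans (qsum-+ u _ _) (+-congˡ (sym (*-qsum u _ _)))) ⟩
    qsum n (λ r u → qsum u (f (suc r))
                  + q ^ r * qsum u (λ t s → f r (suc t) s + q ^ t * f r t (suc s))) ∎

  -- In the induction on `n` the Pascal factor q^(r+r′) splits: q^r belongs to the outer sum, and
  -- q^r′ raises the exponent from r′s to r′(s+1).
  q-vandermonde : ∀ n l f → qsum (n ℕ.+ l) f ≈
    qsum n (λ r s → qsum l λ r′ s′ → q ^ (r′ ℕ.* s) * f (r ℕ.+ r′) (s ℕ.+ s′))
  q-vandermonde zero l f = qsum-cong l λ r s → sym
    (trans (*-congʳ (reflexive (≡.cong (q ^_) (ℕₚ.*-zeroʳ r)))) (*-identityˡ _))
  q-vandermonde (suc n) l f = trans (q-vandermonde n l _) (qsum-cong n λ r s → trans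
    (qsum-cong l λ r′ s′ → trans
      (*-congˡ (+-congˡ (*-congʳ (^-homo-* q r r′))))
      (trans (solve 5 (λ E a Q Q′ b → E :* (a :+ Q :* Q′ :* b) := E :* a :+ Q :* (Q′ :* E :* b))
        refl (q ^ (r′ ℕ.* s)) (f (suc (r ℕ.+ r′)) (s ℕ.+ s′)) (q ^ r) (q ^ r′) (f (r ℕ.+ r′) (suc (s ℕ.+ s′))))
      (+-congˡ (*-congˡ (*-congʳ (trans (sym (^-homo-* q r′ (r′ ℕ.* s)))
        (reflexive (≡.cong (q ^_) (≡.sym (ℕₚ.*-suc r′ s))))))))))
    (trans (qsum-+ l _ _) (+-congˡ (sym (*-qsum l _ _)))))

  -- The entries p, t over r, u form a 2 by 2 table with total n; both sides carry its q-multinomial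
  -- coefficient, once by rows and once by columns.
  regroup : ∀ n (f : ℕ → ℕ → ℕ → ℕ → Carrier) →
    qsum n (λ m s → qsum m λ p t → qsum s λ r u → f p t r u) ≈
    qsum n (λ k l → qsum k λ p r → qsum l λ t u → f p t r u)
  regroup n f = begin
    qsum n (λ m s → qsum m λ p t → qsum s λ r u → f p t r u)
      ≈⟨ qsum-assoc n _ ⟩
    qsum n (λ p w → qsum w λ t s → qsum s λ r u → f p t r u)
      ≈⟨ qsum-cong n (λ p w → trans (sym (qsum-assoc w _)) (trans
           (qsum-cong w λ v u → qsum-swap v _) (qsum-assoc w _))) ⟩
    qsum n (λ p w → qsum w λ r l → qsum l λ t u → f p t r u)
      ≈⟨ qsum-assoc n _ ⟨
    qsum n (λ k l → qsum k λ p r → qsum l λ t u → f p t r u) ∎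

  ⟨_⟩_ : Carrier → ℕ → Carrier
  ⟨ x ⟩ n = qPoch q x n
  infix 8 ⟨_⟩_

  qPoch-cong : ∀ {x y} n → x ≈ y → ⟨ x ⟩ n ≈ ⟨ y ⟩ n
  qPoch-cong zero    e = refl
  qPoch-cong (suc n) e = *-cong (qPoch-cong n e) (+-congˡ (-‿cong (*-congʳ e)))

  qPoch-+ : ∀ x m n → ⟨ x ⟩ (m ℕ.+ n) ≈ ⟨ x ⟩ m * ⟨ x * q ^ m ⟩ n
  qPoch-+ x m zero    = trans (reflexive (≡.cong (qPoch q x) (ℕₚ.+-identityʳ m))) (sym (*-identityʳ _))
  qPoch-+ x m (suc n) = begin
    ⟨ x ⟩ (m ℕ.+ suc n)                       ≡⟨ ≡.cong (qPoch q x) (ℕₚ.+-suc m n) ⟩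
    ⟨ x ⟩ (m ℕ.+ n) * (1# - x * q ^ (m ℕ.+ n))
      ≈⟨ *-cong (qPoch-+ x m n) (+-congˡ (-‿cong
           (trans (*-congˡ (^-homo-* q m n)) (sym (*-assoc _ _ _))))) ⟩
    (⟨ x ⟩ m * ⟨ x * q ^ m ⟩ n) * (1# - x * q ^ m * q ^ n)  ≈⟨ *-assoc _ _ _ ⟩
    ⟨ x ⟩ m * ⟨ x * q ^ m ⟩ (suc n)           ∎

  qPoch-suc : ∀ x n → ⟨ x ⟩ (suc n) ≈ (1# - x) * ⟨ x * q ⟩ n
  qPoch-suc x n = trans (qPoch-+ x 1 n) (*-cong
    (solve 1 (λ x → :1 :* (:1 :- x :* :1) := :1 :- x) refl x)
    (qPoch-cong n (*-congˡ (*-identityʳ q))))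

  q^-+ : ∀ {r s n} → r ℕ.+ s ≡ n → q ^ r * q ^ s ≈ q ^ n
  q^-+ {r} {s} e = trans (sym (^-homo-* q r s)) (reflexive (≡.cong (q ^_) e))

  -- By the second q-Pascal rule each summand is multiplied by μq^s(1 - ρq^l) + (1 - μq^s) = 1 -
  -- μρq^(l+s), which depends on l + s = n only and leaves the sum.
  chu-vandermonde : ∀ μ ρ n → qsum n (λ l s → μ ^ l * ⟨ ρ ⟩ l * ⟨ μ ⟩ s) ≈ ⟨ μ * ρ ⟩ n
  chu-vandermonde μ ρ zero    = trans (*-identityʳ _) (*-identityʳ _)
  chu-vandermonde μ ρ (suc n) = begin
    qsum (suc n) f
      ≈⟨ qsum-suc′ n f ⟩
    qsum n (λ l s → q ^ s * f (suc l) s + f l (suc s))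
      ≈⟨ qsum-cong-∣ n (λ l s l+s≡n → trans
           (solve 7 (λ μ ρ A R M Q T →
               T :* ((μ :* A) :* (R :* (:1 :- ρ :* Q)) :* M) :+ A :* R :* (M :* (:1 :- μ :* T))
               := (:1 :- μ :* ρ :* (Q :* T)) :* (A :* R :* M))
             refl μ ρ (μ ^ l) (⟨ ρ ⟩ l) (⟨ μ ⟩ s) (q ^ l) (q ^ s))
           (*-congʳ (+-congˡ (-‿cong (*-congˡ (q^-+ {l} l+s≡n)))))) ⟩
    qsum n (λ l s → (1# - μ * ρ * q ^ n) * f l s)
      ≈⟨ *-qsum n _ _ ⟨
    (1# - μ * ρ * q ^ n) * qsum n f
      ≈⟨ trans (*-comm _ _) (*-congʳ (chu-vandermonde μ ρ n)) ⟩
    ⟨ μ * ρ ⟩ (suc n) ∎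
    where
    f : ℕ → ℕ → Carrier
    f l s = μ ^ l * ⟨ ρ ⟩ l * ⟨ μ ⟩ s

  -- The q-Saalschütz sum, cleared of denominators.

  module Saalschütz (μ X : Carrier) where
    summand : Carrier → ℕ → ℕ → Carrier
    summand ρ r s = ρ ^ r * ⟨ μ ⟩ r * ⟨ X ⟩ r * (⟨ ρ ⟩ s * ⟨ μ * ρ * X * q ^ r ⟩ s)

    -- Its two expansions as a sum over n + 1 agree (qsum-suc′); their termwise
    -- difference turns the sum over n + 1 for ρ into the sum over n for ρq.
    certificate : Carrier → ℕ → ℕ → Carrier
    certificate ρ r zero    = 0#
    certificate ρ r (suc s) =
      ρ ^ r * ⟨ μ ⟩ r * ⟨ X ⟩ r * (⟨ ρ * q ⟩ s * ⟨ μ * ρ * X * q ^ r ⟩ (suc s))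

    -- At `suc s` the certificate is the summand stripped of the factor 1 - ρ, which is not assumed
    -- invertible; at s = 0 that factor is absent and the certificate is 0, hence two cases.
    certify : ∀ ρ r s → let g = summand ρ; h = certificate ρ in
      (q ^ s * g (suc r) s + g r (suc s)) + (h (suc r) s + q ^ r * h r (suc s)) ≈
      ((1# - μ * ρ) * (1# - ρ * X)) * summand (ρ * q) r s + (q ^ s * h (suc r) s + h r (suc s))
    certify ρ r zero = trans
      (solve 8 (λ μ ρ X q Q A M Y →
          (:1 :* ((ρ :* A) :* (M :* (:1 :- μ :* Q)) :* (Y :* (:1 :- X :* Q)) :* (:1 :* :1))
            :+ A :* M :* Y :* ((:1 :* (:1 :- ρ :* :1)) :* (:1 :* (:1 :- (μ :* ρ :* X :* Q) :* :1))))
            :+ (:0 :+ Q :* (A :* M :* Y :* (:1 :* (:1 :* (:1 :- (μ :* ρ :* X :* Q) :* :1)))))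
          := ((:1 :- μ :* ρ) :* (:1 :- ρ :* X)) :* ((A :* Q) :* M :* Y :* (:1 :* :1))
            :+ (:1 :* :0 :+ A :* M :* Y :* (:1 :* (:1 :* (:1 :- (μ :* ρ :* X :* Q) :* :1)))))
        refl μ ρ X q (q ^ r) (ρ ^ r) (⟨ μ ⟩ r) (⟨ X ⟩ r))
      (+-congʳ (*-congˡ (*-congʳ (*-congʳ (*-congʳ (sym (^-distrib-* ρ q r)))))))
    certify ρ r (suc s) = begin
      (q ^ suc s * summand ρ (suc r) (suc s) + summand ρ r (suc (suc s)))
        + (certificate ρ (suc r) (suc s) + q ^ r * certificate ρ r (suc (suc s)))
        ≈⟨ +-cong (+-cong (*-congˡ (*-congˡ (*-congʳ (qPoch-suc ρ s))))
                          (*-congˡ (*-cong (*-congʳ (qPoch-suc ρ s)) shift)))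
                  (+-congˡ (*-congˡ (*-congˡ (*-congˡ shift)))) ⟩
      (q ^ suc s * (w′ * ((1# - ρ) * L * N)) + w * ((1# - ρ) * L * (1# - ρ * q ^ suc s) * N′))
        + (w′ * (L * N) + q ^ r * (w * (L * (1# - ρ * q * q ^ s) * N′)))
        ≈⟨ solve 11 (λ μ ρ X q Q t A M Y L N →
             let w  = A :* M :* Y
                 w′ = (ρ :* A) :* (M :* (:1 :- μ :* Q)) :* (Y :* (:1 :- X :* Q))
                 N′ = (:1 :- μ :* ρ :* X :* Q) :* N
             in ((q :* t) :* (w′ :* ((:1 :- ρ) :* L :* N))
                  :+ w :* ((:1 :- ρ) :* L :* (:1 :- ρ :* (q :* t)) :* N′))
                  :+ (w′ :* (L :* N) :+ Q :* (w :* (L :* (:1 :- ρ :* q :* t) :* N′)))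
                := ((:1 :- μ :* ρ) :* (:1 :- ρ :* X))
                    :* ((A :* Q) :* M :* Y :* (L :* (:1 :- ρ :* q :* t) :* N))
                  :+ ((q :* t) :* (w′ :* (L :* N)) :+ w :* (L :* (:1 :- ρ :* q :* t) :* N′)))
             refl μ ρ X q (q ^ r) (q ^ s) (ρ ^ r) (⟨ μ ⟩ r) (⟨ X ⟩ r) L N ⟩
      ((1# - μ * ρ) * (1# - ρ * X))
          * (ρ ^ r * q ^ r * ⟨ μ ⟩ r * ⟨ X ⟩ r * (L * (1# - ρ * q * q ^ s) * N))
        + (q ^ suc s * (w′ * (L * N)) + w * (L * (1# - ρ * q * q ^ s) * N′))
        ≈⟨ +-cong
             (*-congˡ (*-cong (*-congʳ (*-congʳ (sym (^-distrib-* ρ q r))))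
               (*-congˡ (qPoch-cong (suc s)
                 (solve 5 (λ μ ρ X q Q → μ :* ρ :* X :* (q :* Q) := μ :* (ρ :* q) :* X :* Q)
                   refl μ ρ X q (q ^ r))))))
             (+-congˡ (*-congˡ (*-congˡ (sym shift)))) ⟩
      ((1# - μ * ρ) * (1# - ρ * X)) * summand (ρ * q) r (suc s)
        + (q ^ suc s * certificate ρ (suc r) (suc s) + certificate ρ r (suc (suc s))) ∎
      where
      w w′ L N N′ : Carrier
      w  = ρ ^ r * ⟨ μ ⟩ r * ⟨ X ⟩ r
      w′ = ρ ^ suc r * ⟨ μ ⟩ (suc r) * ⟨ X ⟩ (suc r)
      L  = ⟨ ρ * q ⟩ s
      N  = ⟨ μ * ρ * X * q ^ suc r ⟩ (suc s)
      N′ = (1# - μ * ρ * X * q ^ r) * N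
      shift : ⟨ μ * ρ * X * q ^ r ⟩ (suc (suc s)) ≈ N′
      shift = trans (qPoch-suc _ (suc s)) (*-congˡ (qPoch-cong (suc s)
        (trans (*-assoc _ _ _) (*-congˡ (*-comm _ _)))))

    -- The induction moves from ρ to ρq, so ρ stays quantified; `C` holds the leading factors of
    -- (μρ;q)_(n+1) and (ρX;q)_(n+1).
    identity : ∀ ρ n → qsum n (summand ρ) ≈ ⟨ μ * ρ ⟩ n * ⟨ ρ * X ⟩ n
    identity ρ zero    = solve 0 (:1 :* :1 :* :1 :* (:1 :* :1) := :1 :* :1) refl
    identity ρ (suc n) = +-cancelʳ (qsum (suc n) (certificate ρ)) _ _ (begin
      qsum (suc n) (summand ρ) + qsum (suc n) (certificate ρ)
        ≈⟨ +-congʳ (qsum-suc′ n (summand ρ)) ⟩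
      _ + _
        ≈⟨ qsum-+ n _ _ ⟨
      _
        ≈⟨ qsum-cong n (certify ρ) ⟩
      _
        ≈⟨ qsum-+ n _ _ ⟩
      _ + _
        ≈⟨ +-cong (*-qsum n _ _) (qsum-suc′ n (certificate ρ)) ⟨
      C * qsum n (summand (ρ * q)) + qsum (suc n) (certificate ρ)
        ≈⟨ +-congʳ (*-congˡ (identity (ρ * q) n)) ⟩
      C * (⟨ μ * (ρ * q) ⟩ n * ⟨ ρ * q * X ⟩ n) + qsum (suc n) (certificate ρ)
        ≈⟨ +-congʳ (trans
             (*-congˡ (*-cong (qPoch-cong n (sym (*-assoc _ _ _)))
               (qPoch-cong n (solve 3 (λ ρ q X → ρ :* q :* X := ρ :* X :* q) refl ρ q X))))
             (trans (solve 4 (λ a b c d → (a :* b) :* (c :* d) := (a :* c) :* (b :* d)) refl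
                      (1# - μ * ρ) (1# - ρ * X) (⟨ μ * ρ * q ⟩ n) (⟨ ρ * X * q ⟩ n))
               (sym (*-cong (qPoch-suc (μ * ρ) n) (qPoch-suc (ρ * X) n))))) ⟩
      ⟨ μ * ρ ⟩ (suc n) * ⟨ ρ * X ⟩ (suc n) + qsum (suc n) (certificate ρ) ∎)
      where
      C : Carrier
      C = (1# - μ * ρ) * (1# - ρ * X)

-- q-Hahn means and their eigenfunctions.

module Exchange (R : CommutativeRing c ℓ) (q : CommutativeRing.Carrier R) where
  open RingOps R
  open QBinomialSum R q
  open Algebra.Properties.CommutativeSemiring.Exp commutativeSemiring
    using (^-homo-*; ^-assocʳ; ^-distrib-*)
  open Relation.Binary.Reasoning.Setoid setoid
  open IntegerCoefficients R using (solve; _:=_; _:*_)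

  InverseSequence : Carrier → (ℕ → Carrier) → Set _
  InverseSequence v J = ∀ n → J n * ⟨ v ⟩ n ≈ 1#

  inverse-resp : ∀ {v w J} → v ≈ w → InverseSequence v J → InverseSequence w J
  inverse-resp e inv n = trans (*-congˡ (qPoch-cong n (sym e))) (inv n)

  inverse-shift : ∀ {v J} → InverseSequence v J → ∀ r s → J (r ℕ.+ s) * ⟨ v * q ^ r ⟩ s ≈ J r
  inverse-shift {v} {J} inv r s = begin
    J (r ℕ.+ s) * ⟨ v * q ^ r ⟩ s
      ≈⟨ trans (*-congʳ (inv r)) (*-identityˡ _) ⟨
    (J r * ⟨ v ⟩ r) * (J (r ℕ.+ s) * ⟨ v * q ^ r ⟩ s)
      ≈⟨ solve 4 (λ a b c d → (a :* b) :* (c :* d) := a :* (c :* (b :* d))) refl _ _ _ _ ⟩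
    J r * (J (r ℕ.+ s) * (⟨ v ⟩ r * ⟨ v * q ^ r ⟩ s))
      ≈⟨ *-congˡ (*-congˡ (qPoch-+ v r s)) ⟨
    J r * (J (r ℕ.+ s) * ⟨ v ⟩ (r ℕ.+ s))
      ≈⟨ trans (*-congˡ (inv (r ℕ.+ s))) (*-identityʳ _) ⟩
    J r ∎

  weight : (μ u : Carrier) → ℕ → ℕ → Carrier
  weight μ u l s = μ ^ l * ⟨ u ⟩ l * ⟨ μ ⟩ s

  -- (μu;q)ₙ times the mean of h under the q-Hahn distribution on {0,…,n}.
  expect : (μ u : Carrier) → ℕ → (ℕ → Carrier) → Carrier
  expect μ u n h = qsum n λ l s → weight μ u l s * h l

  expect-cong : ∀ μ u n {h h′} → (∀ l → h l ≈ h′ l) → expect μ u n h ≈ expect μ u n h′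
  expect-cong μ u n e = qsum-cong n λ l s → *-congˡ (e l)

  -- The general combination of the test functions n ↦ [n;k], with coefficients `z k`. Keeping all
  -- of `z` avoids singling out one [n;k].
  transform : (ℕ → Carrier) → ℕ → Carrier
  transform z n = qsum n λ r _ → z r

  -- The signs and powers (-1)^r q^{r(r-1)/2} of q-binomial inversion.
  σ : ℕ → Carrier
  σ zero    = 1#
  σ (suc r) = - (q ^ r * σ r)

  -- The recursion of `σ` is the one that makes the two q-Pascal terms cancel.
  transform-σ : ∀ n → transform σ (suc n) ≈ 0#
  transform-σ n = trans (qsum-cong n λ r s → -‿inverseˡ _) (qsum-0 n)

  untransform : (ℕ → Carrier) → ℕ → Carrier
  untransform h n = qsum n λ r s → σ s * h r

  -- After reassociation the inner sum is `transform σ u`, which vanishes unless u = 0; only r = n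
  -- survives.
  transform-untransform : ∀ h n → transform (untransform h) n ≈ h n
  transform-untransform h n = begin
    qsum n (λ k t → qsum k λ r s → σ s * h r)     ≈⟨ qsum-assoc n _ ⟩
    qsum n (λ r u → qsum u λ s t → σ s * h r)
      ≈⟨ qsum-cong n (λ r u → trans (qsum-cong u λ s t → *-comm _ _) (sym (*-qsum u _ _))) ⟩
    qsum n (λ r u → h r * transform σ u)          ≈⟨ collapse n h ⟩
    h n                                           ∎
    where
    collapse : ∀ n h → qsum n (λ r u → h r * transform σ u) ≈ h n
    collapse zero    h = *-identityʳ _
    collapse (suc n) h = trans
      (qsum-cong n λ r u → trans
        (+-congˡ (trans (*-congˡ (trans (*-congˡ (transform-σ u)) (zeroʳ _))) (zeroʳ _)))
        (+-identityʳ _))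
      (collapse n (λ r → h (suc r)))

  -- The matrix of the shift n ↦ m + n on the test functions.
  transform-+ : ∀ z m n → transform z (m ℕ.+ n) ≈
    transform (λ j → qsum m λ p t → q ^ (j ℕ.* t) * z (p ℕ.+ j)) n
  transform-+ z m n = trans (q-vandermonde m n _) (qsum-comm m n _)

  -- After [n;l][l;r] = [n;r][n-r;l-r] the weight sheds its first r factors, Chu-Vandermonde with
  -- uq^r gives (μuq^r;q)_(n-r), and the reciprocal of (μu;q)_n reduces to that of (μu;q)_r.
  expect-transform : ∀ {μ u J} → InverseSequence (μ * u) J → ∀ z n →
    J n * expect μ u n (transform z) ≈ transform (λ r → (μ ^ r * ⟨ u ⟩ r * J r) * z r) n
  expect-transform {μ} {u} {J} inv z n = begin
    J n * qsum n (λ l s → weight μ u l s * qsum l λ r t → z r)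
      ≈⟨ *-congˡ (qsum-cong n λ l s → trans (*-qsum l _ _)
           (qsum-cong-∣ l λ { r t ≡.refl → *-congʳ (split r t s) })) ⟩
    J n * qsum n (λ l s → qsum l λ r t → a r * weight μ (u * q ^ r) t s * z r)
      ≈⟨ *-congˡ (qsum-assoc n _) ⟩
    J n * qsum n (λ r k → qsum k λ t s → a r * weight μ (u * q ^ r) t s * z r)
      ≈⟨ *-congˡ (qsum-cong n λ r k → trans
           (qsum-cong k λ t s → solve 3 (λ a w z → a :* w :* z := a :* z :* w) refl _ _ _)
           (trans (sym (*-qsum k _ _)) (*-congˡ (trans (chu-vandermonde μ (u * q ^ r) k)
             (qPoch-cong k (sym (*-assoc _ _ _))))))) ⟩
    J n * qsum n (λ r k → a r * z r * ⟨ μ * u * q ^ r ⟩ k)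
      ≈⟨ trans (*-qsum n _ _) (qsum-cong-∣ n λ { r k ≡.refl → trans
           (solve 4 (λ j a z p → j :* (a :* z :* p) := a :* (j :* p) :* z) refl _ _ _ _)
           (*-congʳ (*-congˡ (inverse-shift inv r k))) }) ⟩
    qsum n (λ r k → a r * J r * z r) ∎
    where
    a : ℕ → Carrier
    a r = μ ^ r * ⟨ u ⟩ r
    split : ∀ r t s → weight μ u (r ℕ.+ t) s ≈ a r * weight μ (u * q ^ r) t s
    split r t s = trans (*-congʳ (*-cong (^-homo-* μ r t) (qPoch-+ u r t)))
      (solve 5 (λ m n a b c → (m :* n) :* (a :* b) :* c := (m :* a) :* (n :* b :* c)) refl _ _ _ _ _)

  -- The exchange relation for two-step means.

  module _ {μ ρ x : Carrier} {I J : ℕ → Carrier}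
           (I-inv : InverseSequence (ρ * x) I) (J-inv : InverseSequence (μ * ρ * x) J) where
    private
      -- The eigenvalues given by `expect-transform` for the pairs (t₁,t₂), (t₁,t₃) and (t₂,t₃).
      c₁₂ c₁₃ c₂₃ : ℕ → Carrier
      c₁₂ i = ρ ^ i * ⟨ x ⟩ i * I i
      c₁₃ i = (μ * ρ) ^ i * ⟨ x ⟩ i * J i
      c₂₃ i = μ ^ i * ⟨ ρ * x ⟩ i * J i

      -- `C` collects what does not depend on p and r. The rest is the q-Saalschütz sum at X = xq^i;
      -- in its value, (ρxq^i;q)_k equals (ρx;q)_(i+k) / (ρx;q)_i, the numerator missing in `c₂₃`
      -- and the denominator missing in `c₁₂`.
      saalschütz-coefficient : ∀ k i →
        qsum k (λ p r → μ ^ p * ⟨ ρ ⟩ p * ⟨ μ ⟩ r * c₁₃ (r ℕ.+ i)) ≈ ⟨ μ * ρ ⟩ k * (c₁₂ i * c₂₃ (k ℕ.+ i))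
      saalschütz-coefficient k i = begin
        qsum k (λ p r → μ ^ p * ⟨ ρ ⟩ p * ⟨ μ ⟩ r * c₁₃ (r ℕ.+ i))
          ≈⟨ qsum-cong-∣ k term ⟩
        qsum k (λ p r → C * summand ρ r p)
          ≈⟨ *-qsum k _ _ ⟨
        C * qsum k (λ p r → summand ρ r p)
          ≈⟨ *-congˡ (trans (sym (qsum-swap k (summand ρ))) (identity ρ k)) ⟩
        C * (⟨ μ * ρ ⟩ k * ⟨ ρ * (x * q ^ i) ⟩ k)
          ≈⟨ *-congˡ (*-congˡ last) ⟩
        C * (⟨ μ * ρ ⟩ k * (I i * ⟨ ρ * x ⟩ (i ℕ.+ k)))
          ≈⟨ solve 7 (λ m r a j v I w → m :* r :* a :* j :* (v :* (I :* w))
                := v :* ((r :* a :* I) :* (m :* w :* j))) refl _ _ _ _ _ _ _ ⟩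
        ⟨ μ * ρ ⟩ k * (c₁₂ i * c₂₃ (i ℕ.+ k))
          ≡⟨ ≡.cong (λ j → ⟨ μ * ρ ⟩ k * (c₁₂ i * c₂₃ j)) (ℕₚ.+-comm i k) ⟩
        ⟨ μ * ρ ⟩ k * (c₁₂ i * c₂₃ (k ℕ.+ i)) ∎
        where
        open Saalschütz μ (x * q ^ i)
        C : Carrier
        C = μ ^ (i ℕ.+ k) * ρ ^ i * ⟨ x ⟩ i * J (i ℕ.+ k)
        last : ⟨ ρ * (x * q ^ i) ⟩ k ≈ I i * ⟨ ρ * x ⟩ (i ℕ.+ k)
        last = begin
          ⟨ ρ * (x * q ^ i) ⟩ k                          ≈⟨ qPoch-cong k (*-assoc _ _ _) ⟨
          ⟨ ρ * x * q ^ i ⟩ k                            ≈⟨ trans (*-congʳ (I-inv i)) (*-identityˡ _) ⟨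
          (I i * ⟨ ρ * x ⟩ i) * ⟨ ρ * x * q ^ i ⟩ k      ≈⟨ *-assoc _ _ _ ⟩
          I i * (⟨ ρ * x ⟩ i * ⟨ ρ * x * q ^ i ⟩ k)      ≈⟨ *-congˡ (qPoch-+ (ρ * x) i k) ⟨
          I i * ⟨ ρ * x ⟩ (i ℕ.+ k)                      ∎
        term : ∀ p r → p ℕ.+ r ≡ k →
          μ ^ p * ⟨ ρ ⟩ p * ⟨ μ ⟩ r * c₁₃ (r ℕ.+ i) ≈ C * summand ρ r p
        term p r p+r≡k = begin
          μ ^ p * ⟨ ρ ⟩ p * ⟨ μ ⟩ r * c₁₃ (r ℕ.+ i)
            ≡⟨ ≡.cong (λ j → μ ^ p * ⟨ ρ ⟩ p * ⟨ μ ⟩ r * c₁₃ j) (ℕₚ.+-comm r i) ⟩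
          μ ^ p * ⟨ ρ ⟩ p * ⟨ μ ⟩ r * ((μ * ρ) ^ (i ℕ.+ r) * ⟨ x ⟩ (i ℕ.+ r) * J (i ℕ.+ r))
            -- The varying denominator is raised to the common (μρx;q)_(i+k); the completing factor
            -- is the last one of the Saalschütz summand.
            ≈⟨ *-congˡ (*-cong (*-cong
                 (trans (^-distrib-* μ ρ (i ℕ.+ r)) (*-congˡ (^-homo-* ρ i r))) (qPoch-+ x i r))
                 (sym (inverse-shift J-inv (i ℕ.+ r) p))) ⟩
          μ ^ p * ⟨ ρ ⟩ p * ⟨ μ ⟩ r * ((μ ^ (i ℕ.+ r) * (ρ ^ i * ρ ^ r)) * (⟨ x ⟩ i * ⟨ x * q ^ i ⟩ r)
            * (J (i ℕ.+ r ℕ.+ p) * ⟨ μ * ρ * x * q ^ (i ℕ.+ r) ⟩ p))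
            ≈⟨ solve 10 (λ a b c d e f g h j k →
                   a :* b :* c :* ((d :* (e :* f)) :* (g :* h) :* (j :* k))
                   := (d :* a) :* e :* g :* j :* (f :* c :* h :* (b :* k))) refl _ _ _ _ _ _ _ _ _ _ ⟩
          (μ ^ (i ℕ.+ r) * μ ^ p) * ρ ^ i * ⟨ x ⟩ i * J (i ℕ.+ r ℕ.+ p)
            * (ρ ^ r * ⟨ μ ⟩ r * ⟨ x * q ^ i ⟩ r * (⟨ ρ ⟩ p * ⟨ μ * ρ * x * q ^ (i ℕ.+ r) ⟩ p))
            ≈⟨ *-cong (*-cong (*-congʳ (*-congʳ (trans (sym (^-homo-* μ (i ℕ.+ r) p))
                                                    (reflexive (≡.cong (μ ^_) eq)))))
                              (reflexive (≡.cong J eq)))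
                      (*-congˡ (*-congˡ (qPoch-cong p (trans (*-congˡ (^-homo-* q i r))
                        (solve 4 (λ v x a b → v :* x :* (a :* b) := v :* (x :* a) :* b) refl _ _ _ _))))) ⟩
          C * summand ρ r p ∎
          where
          eq : i ℕ.+ r ℕ.+ p ≡ i ℕ.+ k
          eq = ≡.trans (ℕₚ.+-assoc i r p) (≡.cong (i ℕ.+_) (≡.trans (ℕₚ.+-comm r p) p+r≡k))

      -- These are the coefficients of [a;i] in the exchange relation. As `z` sees only p + r + i,
      -- the sum is regrouped by k = p + r. The sum over t + u = l is Chu-Vandermonde with
      -- parameters μq^r and ρq^p, whose product μρq^k is the same for all p and r; the sum over p +
      -- r = k is `saalschütz-coefficient`.
      coefficient : ∀ z n i →
        qsum n (λ m s → weight μ ρ m s * qsum s λ r u → q ^ (i ℕ.* u) * (c₁₃ (r ℕ.+ i) *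
          qsum m λ p t → q ^ ((r ℕ.+ i) ℕ.* t) * z (p ℕ.+ (r ℕ.+ i)))) ≈
        ⟨ μ * ρ ⟩ n * (c₁₂ i * qsum n λ k l → q ^ (i ℕ.* l) * (c₂₃ (k ℕ.+ i) * z (k ℕ.+ i)))
      coefficient z n i = begin
        _ ≈⟨ qsum-cong n (λ m s → merge m s) ⟩
        qsum n (λ m s → qsum m λ p t → qsum s λ r u → f p t r u)
          ≈⟨ regroup n f ⟩
        qsum n (λ k l → qsum k λ p r → qsum l λ t u → f p t r u)
          ≈⟨ qsum-cong-∣ n (λ { k l ≡.refl → inner k l }) ⟩
        qsum n (λ k l → ⟨ μ * ρ ⟩ n * c₁₂ i * (q ^ (i ℕ.* l) * (c₂₃ (k ℕ.+ i) * z (k ℕ.+ i))))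
          ≈⟨ *-qsum n _ _ ⟨
        ⟨ μ * ρ ⟩ n * c₁₂ i * qsum n (λ k l → q ^ (i ℕ.* l) * (c₂₃ (k ℕ.+ i) * z (k ℕ.+ i)))
          ≈⟨ *-assoc _ _ _ ⟩
        _ ∎
        where
        f : ℕ → ℕ → ℕ → ℕ → Carrier
        f p t r u = weight μ ρ (p ℕ.+ t) (r ℕ.+ u) * (q ^ (i ℕ.* u) * (c₁₃ (r ℕ.+ i) *
          (q ^ ((r ℕ.+ i) ℕ.* t) * z (p ℕ.+ (r ℕ.+ i)))))

        merge : ∀ m s →
          weight μ ρ m s * qsum s (λ r u → q ^ (i ℕ.* u) * (c₁₃ (r ℕ.+ i) *
            qsum m λ p t → q ^ ((r ℕ.+ i) ℕ.* t) * z (p ℕ.+ (r ℕ.+ i))))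
          ≈ qsum m (λ p t → qsum s λ r u → f p t r u)
        merge m s = begin
          _ ≈⟨ *-congˡ (qsum-cong s λ r u → trans (*-congˡ (*-qsum m _ _)) (*-qsum m _ _)) ⟩
          _ ≈⟨ *-qsum s _ _ ⟩
          _ ≈⟨ qsum-cong s (λ r u → *-qsum m _ _) ⟩
          _ ≈⟨ qsum-comm s m _ ⟩
          -- Replacing m by p + t and s by r + u leaves a summand in four free numbers, as `regroup`
          -- requires.
          _ ≈⟨ qsum-cong-∣ m (λ { p t ≡.refl → qsum-cong-∣ s (λ { r u ≡.refl → refl }) }) ⟩
          _ ∎

        factor : ∀ {k l} p t r u → p ℕ.+ r ≡ k → t ℕ.+ u ≡ l → f p t r u ≈
          (q ^ (i ℕ.* l) * z (k ℕ.+ i)) * (μ ^ p * ⟨ ρ ⟩ p * ⟨ μ ⟩ r * c₁₃ (r ℕ.+ i))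
            * weight (μ * q ^ r) (ρ * q ^ p) t u
        factor {k} {l} p t r u ≡.refl ≡.refl = begin
          f p t r u
            ≈⟨ *-cong (*-cong (*-cong (^-homo-* μ p t) (qPoch-+ ρ p t)) (qPoch-+ μ r u))
                 (*-congˡ (*-congˡ (*-cong power (reflexive (≡.cong z (≡.sym (ℕₚ.+-assoc p r i))))))) ⟩
          ((μ ^ p * μ ^ t) * (⟨ ρ ⟩ p * ⟨ ρ * q ^ p ⟩ t) * (⟨ μ ⟩ r * ⟨ μ * q ^ r ⟩ u))
            * (q ^ (i ℕ.* u) * (c₁₃ (r ℕ.+ i) * ((q ^ r) ^ t * q ^ (i ℕ.* t) * z (k ℕ.+ i))))
            ≈⟨ solve 11 (λ a b c d e f g h j k l →
                 ((a :* b) :* (c :* d) :* (e :* f)) :* (g :* (h :* (j :* k :* l)))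
                 := ((k :* g) :* l) :* (a :* c :* e :* h) :* ((b :* j) :* d :* f))
                 refl _ _ _ _ _ _ _ _ _ _ _ ⟩
          ((q ^ (i ℕ.* t) * q ^ (i ℕ.* u)) * z (k ℕ.+ i))
            * (μ ^ p * ⟨ ρ ⟩ p * ⟨ μ ⟩ r * c₁₃ (r ℕ.+ i))
            * ((μ ^ t * (q ^ r) ^ t) * ⟨ ρ * q ^ p ⟩ t * ⟨ μ * q ^ r ⟩ u)
            ≈⟨ *-cong (*-congʳ (*-congʳ (trans (sym (^-homo-* q (i ℕ.* t) (i ℕ.* u)))
                   (reflexive (≡.cong (q ^_) (≡.sym (ℕₚ.*-distribˡ-+ i t u)))))))
                 (*-congʳ (*-congʳ (sym (^-distrib-* μ (q ^ r) t)))) ⟩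
          _ ∎
          where
          -- q^(rt) turns μ^t into (μq^r)^t, and q^(it) joins q^(iu) to form q^(il).
          power : q ^ ((r ℕ.+ i) ℕ.* t) ≈ (q ^ r) ^ t * q ^ (i ℕ.* t)
          power = begin
            q ^ ((r ℕ.+ i) ℕ.* t)            ≡⟨ ≡.cong (q ^_) (ℕₚ.*-distribʳ-+ t r i) ⟩
            q ^ (r ℕ.* t ℕ.+ i ℕ.* t)        ≈⟨ ^-homo-* q (r ℕ.* t) (i ℕ.* t) ⟩
            q ^ (r ℕ.* t) * q ^ (i ℕ.* t)    ≈⟨ *-congʳ (^-assocʳ q r t) ⟨
            (q ^ r) ^ t * q ^ (i ℕ.* t)      ∎

        inner : ∀ k l → qsum k (λ p r → qsum l λ t u → f p t r u) ≈
          ⟨ μ * ρ ⟩ (k ℕ.+ l) * c₁₂ i * (q ^ (i ℕ.* l) * (c₂₃ (k ℕ.+ i) * z (k ℕ.+ i)))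
        inner k l = begin
          qsum k (λ p r → qsum l λ t u → f p t r u)
            ≈⟨ qsum-cong-∣ k (λ p r p+r≡k → trans
                 (qsum-cong-∣ l (λ t u → factor p t r u p+r≡k))
                 (trans (sym (*-qsum l _ _)) (trans
                   (*-congˡ (trans (chu-vandermonde (μ * q ^ r) (ρ * q ^ p) l) (qPoch-cong l (trans
                     (solve 4 (λ m a n b → (m :* a) :* (n :* b) := m :* n :* (b :* a)) refl _ _ _ _)
                     (*-congˡ (q^-+ {p} p+r≡k))))))
                   (solve 3 (λ a b c → a :* b :* c := (a :* c) :* b) refl _ _ _)))) ⟩
          qsum k (λ p r → (q ^ (i ℕ.* l) * z (k ℕ.+ i) * ⟨ μ * ρ * q ^ k ⟩ l)
                           * (μ ^ p * ⟨ ρ ⟩ p * ⟨ μ ⟩ r * c₁₃ (r ℕ.+ i)))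
            ≈⟨ *-qsum k _ _ ⟨
          (q ^ (i ℕ.* l) * z (k ℕ.+ i) * ⟨ μ * ρ * q ^ k ⟩ l)
            * qsum k (λ p r → μ ^ p * ⟨ ρ ⟩ p * ⟨ μ ⟩ r * c₁₃ (r ℕ.+ i))
            ≈⟨ *-congˡ (saalschütz-coefficient k i) ⟩
          (q ^ (i ℕ.* l) * z (k ℕ.+ i) * ⟨ μ * ρ * q ^ k ⟩ l)
            * (⟨ μ * ρ ⟩ k * (c₁₂ i * c₂₃ (k ℕ.+ i)))
            ≈⟨ solve 6 (λ a z v w c d → (a :* z :* v) :* (w :* (c :* d))
                 := (w :* v) :* c :* (a :* (d :* z))) refl _ _ _ _ _ _ ⟩
          (⟨ μ * ρ ⟩ k * ⟨ μ * ρ * q ^ k ⟩ l) * c₁₂ i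
            * (q ^ (i ℕ.* l) * (c₂₃ (k ℕ.+ i) * z (k ℕ.+ i)))
            ≈⟨ *-congʳ (*-congʳ (qPoch-+ (μ * ρ) k l)) ⟨
          _ ∎

    -- x, ρx and μρx are t₁², t₂² and t₃²; the division by (μρ;q)ₙ that would turn
    -- weight μ ρ into a probability is avoided by multiplying the right-hand side.
    exchange-transform : ∀ z n a →
      qsum n (λ m s → weight μ ρ m s *
        (J (s ℕ.+ a) * expect (μ * ρ) x (s ℕ.+ a) λ b → transform z (m ℕ.+ b))) ≈
      ⟨ μ * ρ ⟩ n * (I a * expect ρ x a λ l → J (n ℕ.+ l) * expect μ (ρ * x) (n ℕ.+ l) (transform z))
    exchange-transform z n a = begin
      _ ≈⟨ qsum-cong n (λ m s → *-congˡ (left m s)) ⟩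
      qsum n (λ m s → weight μ ρ m s * transform (g m s) a)
        ≈⟨ qsum-cong n (λ m s → *-qsum a _ _) ⟩
      qsum n (λ m s → qsum a λ i _ → weight μ ρ m s * g m s i)
        ≈⟨ qsum-comm n a _ ⟩
      qsum a (λ i _ → qsum n λ m s → weight μ ρ m s * g m s i)
        ≈⟨ qsum-cong a (λ i _ → coefficient z n i) ⟩
      qsum a (λ i _ → ⟨ μ * ρ ⟩ n * (c₁₂ i * h i))
        ≈⟨ *-qsum a _ _ ⟨
      ⟨ μ * ρ ⟩ n * transform (λ i → c₁₂ i * h i) a
        ≈⟨ *-congˡ (expect-transform I-inv h a) ⟨
      ⟨ μ * ρ ⟩ n * (I a * expect ρ x a (transform h))
        ≈⟨ *-congˡ (*-congˡ (expect-cong ρ x a λ l → trans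
             (expect-transform (inverse-resp (*-assoc μ ρ x) J-inv) z (n ℕ.+ l))
             (transform-+ _ n l))) ⟨
      _ ∎
      where
      g : ℕ → ℕ → ℕ → Carrier
      g m s i = qsum s λ r u → q ^ (i ℕ.* u) * (c₁₃ (r ℕ.+ i) *
        qsum m λ p t → q ^ ((r ℕ.+ i) ℕ.* t) * z (p ℕ.+ (r ℕ.+ i)))
      h : ℕ → Carrier
      h i = qsum n λ k l → q ^ (i ℕ.* l) * (c₂₃ (k ℕ.+ i) * z (k ℕ.+ i))
      left : ∀ m s → J (s ℕ.+ a) * expect (μ * ρ) x (s ℕ.+ a) (λ b → transform z (m ℕ.+ b))
        ≈ transform (g m s) a
      left m s = trans (*-congˡ (expect-cong (μ * ρ) x (s ℕ.+ a) λ b → transform-+ z m b))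
        (trans (expect-transform J-inv _ (s ℕ.+ a)) (transform-+ _ s a))

    exchange : ∀ h n a →
      qsum n (λ m s → weight μ ρ m s *
        (J (s ℕ.+ a) * expect (μ * ρ) x (s ℕ.+ a) λ b → h (m ℕ.+ b))) ≈
      ⟨ μ * ρ ⟩ n * (I a * expect ρ x a λ l → J (n ℕ.+ l) * expect μ (ρ * x) (n ℕ.+ l) h)
    exchange h n a = begin
      _ ≈⟨ qsum-cong n (λ m s → *-congˡ (*-congˡ (expect-cong (μ * ρ) x (s ℕ.+ a) λ b →
             transform-untransform h (m ℕ.+ b)))) ⟨
      _ ≈⟨ exchange-transform (untransform h) n a ⟩
      _ ≈⟨ *-congˡ (*-congˡ (expect-cong ρ x a λ l → *-congˡ
             (expect-cong μ (ρ * x) (n ℕ.+ l) (transform-untransform h)))) ⟩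
      _ ∎

-- From vertex weights to q-Hahn means.

module YangBaxter (F : CommutativeRing c ℓ) (q : CommutativeRing.Carrier F)
                  (q-inv : ∀ n → RingOps.Inv F (RingOps.qPoch F q q n)) where
  open RingOps F
  open QBinomialSum F q
  open Exchange F q
  open Weight F q q-inv using (Admissible; W)
  open Algebra.Properties.CommutativeSemiring.Exp commutativeSemiring
    using (^-homo-*; ^-assocʳ; ^-congˡ; ^-distrib-*)
  open Algebra.Properties.CommutativeMonoid.Sum +-commutativeMonoid using (∑-comm; sum-cong-≋)
  open Algebra.Properties.Semiring.Sum semiring using (*-distribˡ-sum)
  open Relation.Binary.Reasoning.Setoid setoid
  open IntegerCoefficients F using (solve; _:=_; _:+_; _:*_; _:-_; :1; :0)

  -- Defined by recursion so that `δ (suc r) (suc l)` reduces to `δ r l` in step with `qsum`.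
  δ : ℕ → ℕ → Carrier
  δ zero    zero    = 1#
  δ (suc m) (suc n) = δ m n
  δ zero    (suc n) = 0#
  δ (suc m) zero    = 0#

  δ-refl : ∀ n → δ n n ≈ 1#
  δ-refl zero    = refl
  δ-refl (suc n) = δ-refl n

  δ-≢ : ∀ m n → ¬ (m ≡ n) → δ m n ≈ 0#
  δ-≢ zero    zero    m≢n = contradiction ≡.refl m≢n
  δ-≢ (suc m) (suc n) m≢n = δ-≢ m n λ e → m≢n (≡.cong suc e)
  δ-≢ zero    (suc n) m≢n = refl
  δ-≢ (suc m) zero    m≢n = refl

  qsum-δ-beyond : ∀ {n l} (f : ℕ → ℕ → Carrier) → n ℕ.< l → qsum n (λ r s → δ r l * f r s) ≈ 0#
  qsum-δ-beyond {n} {l} f n<l = trans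
    (qsum-cong-∣ n λ r s r+s≡n → trans (*-congʳ (δ-≢ r l λ r≡l → ℕₚ.<⇒≱ n<l
      (≡.subst₂ ℕ._≤_ r≡l r+s≡n (ℕₚ.m≤m+n r s)))) (zeroˡ _))
    (qsum-0 n)

  qsum-δ-zero : ∀ n (f : ℕ → ℕ → Carrier) → qsum n (λ r s → δ r 0 * f r s) ≈ f 0 n
  qsum-δ-zero zero    f = *-identityˡ _
  qsum-δ-zero (suc n) f = begin
    qsum n (λ r s → 0# * f (suc r) s + q ^ r * (δ r 0 * f r (suc s)))
      ≈⟨ qsum-cong n (λ r s → solve 4 (λ a b d c → :0 :* a :+ b :* (d :* c) := d :* (b :* c)) refl _ _ _ _) ⟩
    qsum n (λ r s → δ r 0 * (q ^ r * f r (suc s)))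
      ≈⟨ qsum-δ-zero n (λ r s → q ^ r * f r (suc s)) ⟩
    1# * f 0 (suc n)
      ≈⟨ *-identityˡ _ ⟩
    f 0 (suc n) ∎

  -- This is [l+m;l] (q;q)_l (q;q)_m = (q;q)_(l+m), the link to the q-factorials in the weight. The
  -- induction rests on (1 - q^(l+1)) + q^(l+1)(1 - q^m) = 1 - q^(l+m+1).
  qsum-δ : ∀ l m (f : ℕ → ℕ → Carrier) →
    ⟨ q ⟩ m * ⟨ q ⟩ l * qsum (l ℕ.+ m) (λ r s → δ r l * f r s) ≈ ⟨ q ⟩ (l ℕ.+ m) * f l m
  qsum-δ zero    m f = *-cong (*-identityʳ _) (qsum-δ-zero m f)
  qsum-δ (suc l) m f = begin
    ⟨ q ⟩ m * ⟨ q ⟩ (suc l) * qsum (l ℕ.+ m) (λ r s → δ r l * f (suc r) s + q ^ r * (δ r (suc l) * f r (suc s)))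
      ≈⟨ *-congˡ (trans (qsum-+ (l ℕ.+ m) _ _) (+-congˡ (qsum-cong (l ℕ.+ m) λ r s →
           solve 3 (λ a b c → a :* (b :* c) := b :* (a :* c)) refl _ _ _))) ⟩
    ⟨ q ⟩ m * ⟨ q ⟩ (suc l) * (A + B m)
      ≈⟨ solve 5 (λ m l d a b → m :* (l :* d) :* (a :+ b) := d :* (m :* l :* a) :+ m :* (l :* d) :* b)
           refl _ _ _ _ _ ⟩
    (1# - q * q ^ l) * (⟨ q ⟩ m * ⟨ q ⟩ l * A) + ⟨ q ⟩ m * ⟨ q ⟩ (suc l) * B m
      ≈⟨ +-cong (*-congˡ (qsum-δ l m (λ r s → f (suc r) s))) (second m) ⟩
    (1# - q * q ^ l) * (⟨ q ⟩ (l ℕ.+ m) * f (suc l) m)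
      + (1# - q ^ m) * (⟨ q ⟩ (l ℕ.+ m) * (q * q ^ l * f (suc l) m))
      ≈⟨ solve 5 (λ q L M P f → (:1 :- q :* L) :* (P :* f) :+ (:1 :- M) :* (P :* (q :* L :* f))
           := P :* (:1 :- q :* (L :* M)) :* f) refl q (q ^ l) (q ^ m) _ _ ⟩
    ⟨ q ⟩ (l ℕ.+ m) * (1# - q * (q ^ l * q ^ m)) * f (suc l) m
      ≈⟨ *-congʳ (*-congˡ (+-congˡ (-‿cong (*-congˡ (^-homo-* q l m))))) ⟨
    ⟨ q ⟩ (suc l ℕ.+ m) * f (suc l) m ∎
    where
    A : Carrier
    A = qsum (l ℕ.+ m) λ r s → δ r l * f (suc r) s
    B : ℕ → Carrier
    B m = qsum (l ℕ.+ m) λ r s → δ r (suc l) * (q ^ r * f r (suc s))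
    second : ∀ m → ⟨ q ⟩ m * ⟨ q ⟩ (suc l) * B m ≈
      (1# - q ^ m) * (⟨ q ⟩ (l ℕ.+ m) * (q * q ^ l * f (suc l) m))
    -- Both sides vanish: the index `suc l` exceeds the range l, and 1 - q^0 = 0.
    second zero = trans
      (*-congˡ (qsum-δ-beyond {l ℕ.+ 0} (λ r s → q ^ r * f r (suc s)) (ℕ.s≤s (ℕₚ.≤-reflexive (ℕₚ.+-identityʳ l)))))
      (solve 2 (λ a b → a :* :0 := (:1 :- :1) :* b) refl _ _)
    second (suc m) = begin
      ⟨ q ⟩ (suc m) * ⟨ q ⟩ (suc l) * qsum (l ℕ.+ suc m) (λ r s → δ r (suc l) * (q ^ r * f r (suc s)))
        ≡⟨ ≡.cong (λ n → ⟨ q ⟩ (suc m) * ⟨ q ⟩ (suc l) * qsum n (λ r s → δ r (suc l) * (q ^ r * f r (suc s))))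
             (ℕₚ.+-suc l m) ⟩
      ⟨ q ⟩ (suc m) * ⟨ q ⟩ (suc l) * qsum (suc l ℕ.+ m) (λ r s → δ r (suc l) * (q ^ r * f r (suc s)))
        ≈⟨ solve 4 (λ a d b x → a :* d :* b :* x := d :* (a :* b :* x)) refl _ _ _ _ ⟩
      (1# - q ^ suc m) * (⟨ q ⟩ m * ⟨ q ⟩ (suc l)
        * qsum (suc l ℕ.+ m) (λ r s → δ r (suc l) * (q ^ r * f r (suc s))))
        ≈⟨ *-congˡ (qsum-δ (suc l) m (λ r s → q ^ r * f r (suc s))) ⟩
      (1# - q ^ suc m) * (⟨ q ⟩ (suc l ℕ.+ m) * (q * q ^ l * f (suc l) (suc m)))
        ≡⟨ ≡.cong (λ n → (1# - q ^ suc m) * (⟨ q ⟩ n * (q * q ^ l * f (suc l) (suc m)))) (ℕₚ.+-suc l m) ⟨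
      _ ∎

  ∑ : ℕ → (ℕ → Carrier) → Carrier
  ∑ N f = sum {N} λ l → f (toℕ l)

  ∑-cong : ∀ N {f g : ℕ → Carrier} → (∀ l → f l ≈ g l) → ∑ N f ≈ ∑ N g
  ∑-cong N e = sum-cong-≋ {N} λ l → e (toℕ l)

  *-∑ : ∀ N x (f : ℕ → Carrier) → x * ∑ N f ≈ ∑ N λ l → x * f l
  *-∑ N x f = *-distribˡ-sum {N} x _

  ∑-factor : ∀ N x (f g : ℕ → Carrier) → ∑ N (λ l → x * f l * g l) ≈ x * ∑ N λ l → f l * g l
  ∑-factor N x f g = trans (∑-cong N λ l → *-assoc x (f l) (g l)) (sym (*-∑ N x λ l → f l * g l))

  ∑-swap : ∀ N (f : ℕ → ℕ → Carrier) → ∑ N (λ k → ∑ N (f k)) ≈ ∑ N λ l → ∑ N λ k → f k l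
  ∑-swap N f = ∑-comm {N} {N} λ k l → f (toℕ k) (toℕ l)

  ∑-qsum : ∀ N n (f : ℕ → ℕ → ℕ → Carrier) →
    ∑ N (λ l → qsum n (f l)) ≈ qsum n λ r s → ∑ N λ l → f l r s
  ∑-qsum zero    n f = sym (qsum-0 n)
  ∑-qsum (suc N) n f = trans (+-congˡ (∑-qsum N n λ l → f (suc l))) (sym (qsum-+ n _ _))

  ∑-δ : ∀ {N m} (f : ℕ → Carrier) → m ℕ.< N → ∑ N (λ l → δ m l * f l) ≈ f m
  ∑-δ {suc N} {zero}  f _ = trans
    (+-cong (*-identityˡ _) (trans (sym (*-∑ N 0# λ l → f (suc l))) (zeroˡ _))) (+-identityʳ _)
  ∑-δ {suc N} {suc m} f (ℕ.s≤s m<N) = trans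
    (+-cong (zeroˡ _) (∑-δ (λ l → f (suc l)) m<N)) (+-identityˡ _)

  ∑-sift : ∀ N n x (w : ℕ → ℕ → Carrier) (p : ℕ → ℕ → ℕ) (G : ℕ → ℕ → ℕ → Carrier) →
    (∀ r v → r ℕ.+ v ≡ n → p r v ℕ.< N) →
    ∑ N (λ l → x * qsum n λ r v → w r v * (δ (p r v) l * G l r v)) ≈
    x * qsum n λ r v → w r v * G (p r v) r v
  ∑-sift N n x w p G p<N = begin
    ∑ N (λ l → x * qsum n λ r v → w r v * (δ (p r v) l * G l r v))
      ≈⟨ *-∑ N x (λ l → qsum n λ r v → w r v * (δ (p r v) l * G l r v)) ⟨
    x * ∑ N (λ l → qsum n λ r v → w r v * (δ (p r v) l * G l r v))
      ≈⟨ *-congˡ (∑-qsum N n λ l r v → w r v * (δ (p r v) l * G l r v)) ⟩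
    x * qsum n (λ r v → ∑ N λ l → w r v * (δ (p r v) l * G l r v))
      ≈⟨ *-congˡ (qsum-cong-∣ n λ r v e → trans (sym (*-∑ N (w r v) λ l → δ (p r v) l * G l r v))
           (*-congˡ (∑-δ (λ l → G l r v) (p<N r v e)))) ⟩
    x * qsum n (λ r v → w r v * G (p r v) r v) ∎

  /-≈ : ∀ {x y z} (y-inv : Inv y) → x ≈ z * y → x / y [ y-inv ] ≈ z
  /-≈ (y⁻¹ , _ , yy⁻¹≈1) x≈zy = trans (*-congʳ x≈zy)
    (trans (*-assoc _ _ _) (trans (*-congˡ yy⁻¹≈1) (*-identityʳ _)))

  𝟏-yes : ∀ {p} {P : Set p} (d : Dec P) → P → 𝟏 d ≈ 1#
  𝟏-yes (yes _) _ = refl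
  𝟏-yes (no ¬p) p = contradiction p ¬p

  𝟏-no : ∀ {p} {P : Set p} (d : Dec P) → ¬ P → 𝟏 d ≈ 0#
  𝟏-no (yes p) ¬p = contradiction p ¬p
  𝟏-no (no _)  _  = refl

  𝟏-conservation : ∀ l m j k → 𝟏 (l ℕ.+ m ℕ.+ j ℕₚ.≟ k ℕ.+ l) ≈ δ (m ℕ.+ j) k
  𝟏-conservation l m j k with l ℕ.+ m ℕ.+ j ℕₚ.≟ k ℕ.+ l
  ... | yes e = sym (trans (reflexive (≡.cong (λ n → δ n k) m+j≡k)) (δ-refl k))
    where
    m+j≡k : m ℕ.+ j ≡ k
    m+j≡k = ℕₚ.+-cancelˡ-≡ l _ _ (≡.trans (≡.sym (ℕₚ.+-assoc l m j)) (≡.trans e (ℕₚ.+-comm k l)))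
  ... | no ≢ = sym (δ-≢ (m ℕ.+ j) k λ { ≡.refl → ≢ (≡.trans (ℕₚ.+-assoc l m j) (ℕₚ.+-comm l (m ℕ.+ j))) })

  -- With u = t² and μ = s²/t², the weight is the q-Hahn probability
  -- [i;l] μ^l (u;q)_l (μ;q)_{i-l} / (μu;q)_i times the conservation indicator.
  record QHahn {t s : Carrier} (adm : Admissible t s) (μ u : Carrier) (J : ℕ → Carrier) : Set ℓ where
    field
      u≈t²    : u ≈ t ^ 2
      μu≈s²   : μ * u ≈ s ^ 2
      inverse : InverseSequence (μ * u) J

    open Admissible adm

    s²≈μt² : s ^ 2 ≈ μ * t ^ 2
    s²≈μt² = trans (sym μu≈s²) (*-congˡ u≈t²)

    s^2l≈μ^lt^2l : ∀ l → s ^ (2 ℕ.* l) ≈ μ ^ l * t ^ (2 ℕ.* l)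
    s^2l≈μ^lt^2l l = begin
      s ^ (2 ℕ.* l)            ≈⟨ ^-assocʳ s 2 l ⟨
      (s ^ 2) ^ l              ≈⟨ ^-congˡ l s²≈μt² ⟩
      (μ * t ^ 2) ^ l          ≈⟨ ^-distrib-* μ (t ^ 2) l ⟩
      μ ^ l * (t ^ 2) ^ l      ≈⟨ *-congˡ (^-assocʳ t 2 l) ⟩
      μ ^ l * t ^ (2 ℕ.* l)    ∎

    summand : ℕ → ℕ → ℕ → ℕ → Carrier
    summand j k r v = weight μ u r v * δ (v ℕ.+ j) k

    -- For l > i no r in the sum reaches l, which reproduces the indicator of i ≥ l; for l ≤ i,
    -- `qsum-δ` extracts the single term.
    W-qsum : ∀ i j k l →
      W t s adm i j k l ≈ J i * qsum i λ r v → weight μ u r v * (δ r l * δ (v ℕ.+ j) k)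
    W-qsum i j k l = trans W-select (*-congˡ (qsum-cong i λ r v →
      solve 3 (λ a b c → a :* (b :* c) := b :* (a :* c)) refl _ _ _))
      where
      W-select : W t s adm i j k l ≈ J i * qsum i λ r v → δ r l * summand j k r v
      W-select with l ℕₚ.≤? i
      ... | no l≰i = begin
        _ ≈⟨ *-congʳ (*-congʳ (*-congʳ (zeroʳ _))) ⟩
        _ ≈⟨ solve 3 (λ a b c → :0 :* a :* b :* c := :0) refl _ _ _ ⟩
        0# ≈⟨ zeroʳ _ ⟨
        J i * 0# ≈⟨ *-congˡ (qsum-δ-beyond {i} {l} (summand j k) (ℕₚ.≰⇒> l≰i)) ⟨
        _ ∎
      ... | yes l≤i with ℕₚ.m≤n⇒∃[o]m+o≡n l≤i
      ... | m , ≡.refl = begin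
        _ ≈⟨ *-congʳ (*-cong (*-cong (*-congʳ (𝟏-conservation l m j k))
               (/-≈ (inv-^ t-inv (2 ℕ.* l)) (s^2l≈μ^lt^2l l)))
               (*-cong (*-cong (trans (qPoch-cong (l ℕ.+ m ℕ.∸ l) (/-≈ (inv-^ t-inv 2) s²≈μt²))
                                      (reflexive (≡.cong (qPoch q μ) (ℕₚ.m+n∸m≡n l m))))
                               (qPoch-cong l (sym u≈t²)))
                       J-unique)) ⟩
        _ ≈⟨ solve 7 (λ d a b c j p ι → d :* :1 :* a :* (b :* c :* j) :* (p :* ι)
               := j :* ((p :* (a :* c :* b :* d)) :* ι)) refl _ _ _ _ _ _ _ ⟩
        _ ≈⟨ *-congˡ (/-≈ (inv-* (q-inv (l ℕ.+ m ℕ.∸ l)) (q-inv l)) selected) ⟩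
        J i * qsum i (λ r v → δ r l * summand j k r v) ∎
        where
        -- Reciprocals are unique, so `J` may come from another admissible pair with the same s²:
        -- `w₂₃` borrows it from `t₁-t₃`.
        J-unique : proj₁ (s²-inv (l ℕ.+ m)) ≈ J (l ℕ.+ m)
        J-unique with y , _ , xy≈1 ← s²-inv (l ℕ.+ m) = begin
          y                                                 ≈⟨ *-identityˡ y ⟨
          1# * y                                            ≈⟨ *-congʳ (inverse (l ℕ.+ m)) ⟨
          J (l ℕ.+ m) * ⟨ μ * u ⟩ (l ℕ.+ m) * y             ≈⟨ *-assoc _ _ _ ⟩
          J (l ℕ.+ m) * (⟨ μ * u ⟩ (l ℕ.+ m) * y)
            ≈⟨ *-congˡ (trans (*-congʳ (qPoch-cong (l ℕ.+ m) μu≈s²)) xy≈1) ⟩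
          J (l ℕ.+ m) * 1#                                  ≈⟨ *-identityʳ _ ⟩
          J (l ℕ.+ m)                                       ∎
        selected : ⟨ q ⟩ (l ℕ.+ m) * summand j k l m ≈
          qsum (l ℕ.+ m) (λ r v → δ r l * summand j k r v) * (⟨ q ⟩ (l ℕ.+ m ℕ.∸ l) * ⟨ q ⟩ l)
        selected = begin
          _ ≈⟨ qsum-δ l m (summand j k) ⟨
          _ ≈⟨ *-comm _ _ ⟩
          _ ≡⟨ ≡.cong (λ n → qsum (l ℕ.+ m) (λ r v → δ r l * summand j k r v) * (⟨ q ⟩ n * ⟨ q ⟩ l))
                 (ℕₚ.m+n∸m≡n l m) ⟨
          _ ∎

    ∑-outgoing-l : ∀ {N i} j k (f : ℕ → Carrier) → i ℕ.< N →
      ∑ N (λ l → W t s adm i j k l * f l) ≈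
      J i * qsum i λ r v → weight μ u r v * (δ (v ℕ.+ j) k * f r)
    ∑-outgoing-l {N} {i} j k f i<N = trans
      (∑-cong N λ l → trans (*-congʳ (W-qsum i j k l)) (trans (*-assoc _ _ _) (*-congˡ
        (trans (*-comm _ (f l)) (trans (*-qsum i _ _) (qsum-cong i λ r v →
          solve 4 (λ f w a b → f :* (w :* (a :* b)) := w :* (a :* (b :* f))) refl _ _ _ _))))))
      (∑-sift N i (J i) (weight μ u) (λ r v → r) (λ l r v → δ (v ℕ.+ j) k * f l)
        λ { r v ≡.refl → ℕₚ.≤-<-trans (ℕₚ.m≤m+n r v) i<N })

    ∑-outgoing-k : ∀ {N i} j l (f : ℕ → Carrier) → i ℕ.+ j ℕ.< N →
      ∑ N (λ k → W t s adm i j k l * f k) ≈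
      J i * qsum i λ r v → weight μ u r v * (δ r l * f (v ℕ.+ j))
    ∑-outgoing-k {N} {i} j l f i+j<N = trans
      (∑-cong N λ k → trans (*-congʳ (W-qsum i j k l)) (trans (*-assoc _ _ _) (*-congˡ
        (trans (*-comm _ (f k)) (trans (*-qsum i _ _) (qsum-cong i λ r v →
          solve 4 (λ f w a b → f :* (w :* (a :* b)) := w :* (b :* (a :* f))) refl _ _ _ _))))))
      (∑-sift N i (J i) (weight μ u) (λ r v → v ℕ.+ j) (λ k r v → δ r l * f k)
        λ { r v ≡.refl → ℕₚ.≤-<-trans (ℕₚ.+-monoˡ-≤ j (ℕₚ.m≤n+m v r)) i+j<N })

    ∑-outgoing : ∀ {N i} j (f : ℕ → ℕ → Carrier) → i ℕ.+ j ℕ.< N →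
      ∑ N (λ l → ∑ N λ k → W t s adm i j k l * f k l) ≈
      J i * qsum i λ r v → weight μ u r v * f (v ℕ.+ j) r
    ∑-outgoing {N} {i} j f i+j<N = trans
      (∑-cong N λ l → ∑-outgoing-k j l (λ k → f k l) i+j<N)
      (∑-sift N i (J i) (weight μ u) (λ r v → r) (λ l r v → f (v ℕ.+ j) l)
        λ { r v ≡.refl → ℕₚ.≤-<-trans (ℕₚ.≤-trans (ℕₚ.m≤m+n r v) (ℕₚ.m≤m+n _ j)) i+j<N })

  -- The first two arrows of the left-hand side compose to a q-Hahn weight,
  -- which reduces the equation to the exchange relation.
  expect-compose : ∀ {μ ρ x y I J K}
    → InverseSequence (ρ * x) I → InverseSequence (μ * ρ * x) J → InverseSequence (ρ * y) K
    → ∀ (h : ℕ → ℕ → Carrier) n a →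
    qsum n (λ l s → weight μ (ρ * y) l s * (J (s ℕ.+ a) *
      qsum (s ℕ.+ a) λ l′ s′ → weight (μ * ρ) x l′ s′ * (K l *
        qsum l λ b v → weight ρ y b v * h b (v ℕ.+ l′)))) ≈
    I a * qsum a λ l s → weight ρ x l s *
      qsum n λ b m → weight (μ * ρ) y b m * (J (m ℕ.+ l) * expect μ (ρ * x) (m ℕ.+ l) (h b))
  expect-compose {μ} {ρ} {x} {y} {I} {J} {K} I-inv J-inv K-inv h n a = begin
    _ ≈⟨ qsum-cong n (λ l s → collect l s) ⟩
    qsum n (λ l s → qsum l λ b v → d b * (weight μ ρ v s * g b v s))
      ≈⟨ qsum-assoc n _ ⟩
    qsum n (λ b m → qsum m λ v s → d b * (weight μ ρ v s * g b v s))
      ≈⟨ qsum-cong n (λ b m → trans (sym (*-qsum m _ _)) (*-congˡ (exchange I-inv J-inv (h b) m a))) ⟩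
    qsum n (λ b m → d b * (⟨ μ * ρ ⟩ m * (I a * expect ρ x a (f b m))))
      -- The factor (μρ;q)_m left by the exchange relation completes `d b` to
      -- `weight (μ * ρ) y b m`.
      ≈⟨ qsum-cong n (λ b m → trans
           (solve 4 (λ d p i e → d :* (p :* (i :* e)) := i :* (d :* p :* e)) refl _ _ _ _)
           (*-congˡ (trans (*-qsum a _ _) (qsum-cong a λ l s →
             solve 3 (λ v w f → v :* (w :* f) := w :* (v :* f)) refl _ _ _)))) ⟩
    qsum n (λ b m → I a * qsum a λ l s → weight ρ x l s * (weight (μ * ρ) y b m * f b m l))
      ≈⟨ *-qsum n _ _ ⟨
    I a * qsum n (λ b m → qsum a λ l s → weight ρ x l s * (weight (μ * ρ) y b m * f b m l))
      ≈⟨ *-congˡ (trans (qsum-comm n a _) (qsum-cong a λ l s → sym (*-qsum n _ _))) ⟩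
    I a * qsum a (λ l s → weight ρ x l s * qsum n λ b m → weight (μ * ρ) y b m * f b m l) ∎
    where
    d : ℕ → Carrier
    d b = (μ * ρ) ^ b * ⟨ y ⟩ b
    f : ℕ → ℕ → ℕ → Carrier
    f b m l = J (m ℕ.+ l) * expect μ (ρ * x) (m ℕ.+ l) (h b)
    g : ℕ → ℕ → ℕ → Carrier
    g b v s = J (s ℕ.+ a) * expect (μ * ρ) x (s ℕ.+ a) λ l′ → h b (v ℕ.+ l′)
    collect : ∀ l s →
      weight μ (ρ * y) l s * (J (s ℕ.+ a) *
        qsum (s ℕ.+ a) λ l′ s′ → weight (μ * ρ) x l′ s′ * (K l *
          qsum l λ b v → weight ρ y b v * h b (v ℕ.+ l′))) ≈
      qsum l (λ b v → d b * (weight μ ρ v s * g b v s))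
    collect l s = begin
      _ ≈⟨ *-congˡ (*-congˡ (trans
             (qsum-cong (s ℕ.+ a) λ l′ s′ → trans (*-congˡ (*-qsum l _ _)) (*-qsum l _ _))
             (qsum-comm (s ℕ.+ a) l _))) ⟩
      _ ≈⟨ trans (*-congˡ (*-qsum l _ _)) (*-qsum l _ _) ⟩
      _ ≈⟨ qsum-cong-∣ l (λ { b v ≡.refl → trans
             (*-congˡ (*-congˡ (trans (qsum-cong (s ℕ.+ a) λ l′ s′ →
               solve 4 (λ w k w′ h → w :* (k :* (w′ :* h)) := (k :* w′) :* (w :* h)) refl _ _ _ _)
               (sym (*-qsum (s ℕ.+ a) _ _)))))
             (regroup-weights b v) }) ⟩
      _ ∎
      where
      -- (ρy;q)_(b+v) is a numerator of the first weight and the denominator of the third; once it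
      -- cancels, y survives in `d b` only.
      regroup-weights : ∀ b v {e} →
        weight μ (ρ * y) (b ℕ.+ v) s * (J (s ℕ.+ a) * ((K (b ℕ.+ v) * weight ρ y b v) * e)) ≈
        d b * (weight μ ρ v s * (J (s ℕ.+ a) * e))
      regroup-weights b v {e} = begin
        _ ≈⟨ *-congʳ (*-congʳ (*-congʳ (^-homo-* μ b v))) ⟩
        _ ≈⟨ solve 10 (λ m n p u j k r y q e →
               ((m :* n) :* p :* u) :* (j :* ((k :* (r :* y :* q)) :* e))
               := (k :* p) :* (((m :* r) :* y) :* ((n :* q :* u) :* (j :* e))))
             refl (μ ^ b) (μ ^ v) _ _ _ _ _ _ _ e ⟩
        _ ≈⟨ trans (*-congʳ (K-inv (b ℕ.+ v))) (*-identityˡ _) ⟩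
        _ ≈⟨ *-congʳ (*-congʳ (^-distrib-* μ ρ b)) ⟨
        _ ∎

  -- Both sides of the equation reduced to a common expression.

  module _ {t₁ t₂ t₃ η : Carrier}
    (t₁-t₂ : Admissible t₁ t₂) (t₁-t₃ : Admissible t₁ t₃) (t₂-t₃ : Admissible t₂ t₃)
    (ηt₁-ηt₂ : Admissible (η * t₁) (η * t₂)) (ηt₁-ηt₃ : Admissible (η * t₁) (η * t₃))
    (ηt₂-ηt₃ : Admissible (η * t₂) (η * t₃)) where
    private
      x y ρ μ : Carrier
      x = t₁ ^ 2
      y = (η * t₁) ^ 2
      ρ = t₂ ^ 2 / t₁ ^ 2 [ inv-^ (Admissible.t-inv t₁-t₂) 2 ]
      μ = t₃ ^ 2 / t₂ ^ 2 [ inv-^ (Admissible.t-inv t₂-t₃) 2 ]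

      /-* : ∀ {a b} (b-inv : Inv b) → a / b [ b-inv ] * b ≈ a
      /-* (_ , b⁻¹b≈1 , _) = trans (*-assoc _ _ _) (trans (*-congˡ b⁻¹b≈1) (*-identityʳ _))

      ρx≈t₂² : ρ * x ≈ t₂ ^ 2
      ρx≈t₂² = /-* (inv-^ (Admissible.t-inv t₁-t₂) 2)

      μt₂²≈t₃² : μ * t₂ ^ 2 ≈ t₃ ^ 2
      μt₂²≈t₃² = /-* (inv-^ (Admissible.t-inv t₂-t₃) 2)

      μρx≈t₃² : μ * ρ * x ≈ t₃ ^ 2
      μρx≈t₃² = trans (*-assoc _ _ _) (trans (*-congˡ ρx≈t₂²) μt₂²≈t₃²)

      -- Scaling by η preserves ratios, so the same μ and ρ serve all six weights.
      scale : ∀ {a b c} → a * b ^ 2 ≈ c ^ 2 → a * (η * b) ^ 2 ≈ (η * c) ^ 2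
      scale {a} {b} {c} e = begin
        a * (η * b) ^ 2          ≈⟨ *-congˡ (^-distrib-* η b 2) ⟩
        a * (η ^ 2 * b ^ 2)      ≈⟨ solve 3 (λ a h b → a :* (h :* b) := h :* (a :* b)) refl _ _ _ ⟩
        η ^ 2 * (a * b ^ 2)      ≈⟨ *-congˡ e ⟩
        η ^ 2 * c ^ 2            ≈⟨ ^-distrib-* η c 2 ⟨
        (η * c) ^ 2              ∎

      ρy≈ : ρ * y ≈ (η * t₂) ^ 2
      ρy≈ = scale ρx≈t₂²

      μρy≈ : μ * ρ * y ≈ (η * t₃) ^ 2
      μρy≈ = scale μρx≈t₃²

      inverses : ∀ {t s} → Admissible t s → ℕ → Carrier
      inverses adm n = proj₁ (Admissible.s²-inv adm n)

      inverses-inverse : ∀ {t s v} (adm : Admissible t s) → v ≈ s ^ 2 → InverseSequence v (inverses adm)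
      inverses-inverse adm v≈s² n = trans (*-congˡ (qPoch-cong n v≈s²))
        (proj₁ (proj₂ (Admissible.s²-inv adm n)))

      I J K L : ℕ → Carrier
      I = inverses t₁-t₂
      J = inverses t₁-t₃
      K = inverses ηt₁-ηt₂
      L = inverses ηt₁-ηt₃

      I-inv : InverseSequence (ρ * x) I
      I-inv = inverses-inverse t₁-t₂ ρx≈t₂²
      J-inv : InverseSequence (μ * ρ * x) J
      J-inv = inverses-inverse t₁-t₃ μρx≈t₃²
      K-inv : InverseSequence (ρ * y) K
      K-inv = inverses-inverse ηt₁-ηt₂ ρy≈
      L-inv : InverseSequence (μ * ρ * y) L
      L-inv = inverses-inverse ηt₁-ηt₃ μρy≈

      w₁₂ : QHahn t₁-t₂ ρ x I
      w₁₂ = record { u≈t² = refl ; μu≈s² = ρx≈t₂² ; inverse = I-inv }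
      w₁₃ : QHahn t₁-t₃ (μ * ρ) x J
      w₁₃ = record { u≈t² = refl ; μu≈s² = μρx≈t₃² ; inverse = J-inv }
      w₂₃ : QHahn t₂-t₃ μ (ρ * x) J
      w₂₃ = record { u≈t² = ρx≈t₂² ; μu≈s² = trans (sym (*-assoc _ _ _)) μρx≈t₃²
                   ; inverse = inverse-resp (*-assoc _ _ _) J-inv }
      ηw₁₂ : QHahn ηt₁-ηt₂ ρ y K
      ηw₁₂ = record { u≈t² = refl ; μu≈s² = ρy≈ ; inverse = K-inv }
      ηw₁₃ : QHahn ηt₁-ηt₃ (μ * ρ) y L
      ηw₁₃ = record { u≈t² = refl ; μu≈s² = μρy≈ ; inverse = L-inv }
      ηw₂₃ : QHahn ηt₂-ηt₃ μ (ρ * y) L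
      ηw₂₃ = record { u≈t² = ρy≈ ; μu≈s² = trans (sym (*-assoc _ _ _)) μρy≈
                    ; inverse = inverse-resp (*-assoc _ _ _) L-inv }

      module W₁₂  = QHahn w₁₂
      module W₁₃  = QHahn w₁₃
      module W₂₃  = QHahn w₂₃
      module ηW₁₂ = QHahn ηw₁₂
      module ηW₁₃ = QHahn ηw₁₃
      module ηW₂₃ = QHahn ηw₂₃

    module _ (a₁ a₂ a₃ b₁ b₂ b₃ : ℕ) where
      private
        A : ℕ
        A = a₁ ℕ.+ a₂ ℕ.+ a₃

        -- By conservation the third outgoing arrow is A - (b + d).
        h : ℕ → ℕ → Carrier
        h b d = δ b b₁ * (δ d b₂ * δ (A ℕ.∸ (b ℕ.+ d)) b₃)

        -- The exchange relation tests functions of one number, so for fixed b the condition on b₃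
        -- must be read off d; conservation makes the truncated subtraction exact.
        third-arrow : ∀ {b d e} → b ℕ.+ d ℕ.+ e ≡ A → δ e b₃ ≈ δ (A ℕ.∸ (b ℕ.+ d)) b₃
        third-arrow {b} {d} {e} eq = reflexive (≡.cong (λ n → δ n b₃)
          (≡.sym (≡.trans (≡.cong (ℕ._∸ (b ℕ.+ d)) (≡.sym eq)) (ℕₚ.m+n∸m≡n (b ℕ.+ d) e))))

        -- The right-hand side without the reciprocal `L a₃`. Both sides have that factor, since
        -- each weight with first argument a₃ has second parameter ηt₃.
        middle : Carrier
        middle = I a₂ * qsum a₂ λ l s → weight ρ x l s *
          qsum a₃ λ b m → weight (μ * ρ) y b m * (J (m ℕ.+ l) * expect μ (ρ * x) (m ℕ.+ l) (h b))

      lhs rhs : ℕ → ℕ → ℕ → Carrier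
      lhs l₁ l₂ l₃ = W (η * t₂) (η * t₃) ηt₂-ηt₃ a₃ a₂ l₃ l₂
        * W t₁ t₃ t₁-t₃ l₃ a₁ b₃ l₁ * W (η * t₁) (η * t₂) ηt₁-ηt₂ l₂ l₁ b₂ b₁
      rhs l₁ l₂ l₃ = W t₁ t₂ t₁-t₂ a₂ a₁ l₂ l₁
        * W (η * t₁) (η * t₃) ηt₁-ηt₃ a₃ l₁ l₃ b₁ * W t₂ t₃ t₂-t₃ l₃ l₂ b₃ b₂

      private
        -- The truncation chosen by `lhs-finite` and `rhs-finite`, so these sums unfold to those of
        -- the theorem.
        N : ℕ
        N = suc A

        lhs≈middle : ∑ N (λ l₁ → ∑ N λ l₂ → ∑ N λ l₃ → lhs l₁ l₂ l₃) ≈ L a₃ * middle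
        lhs≈middle = begin
          ∑ N (λ l₁ → ∑ N λ l₂ → ∑ N λ l₃ → lhs l₁ l₂ l₃)
            -- l₁ goes innermost: the first weight determines how l₂ and l₃ are distributed, and l₁
            -- is then drawn from l₃.
            ≈⟨ ∑-swap N (λ l₁ l₂ → ∑ N λ l₃ → lhs l₁ l₂ l₃) ⟩
          ∑ N (λ l₂ → ∑ N λ l₁ → ∑ N λ l₃ → lhs l₁ l₂ l₃)
            ≈⟨ ∑-cong N (λ l₂ → ∑-swap N λ l₁ l₃ → lhs l₁ l₂ l₃) ⟩
          ∑ N (λ l₂ → ∑ N λ l₃ → ∑ N λ l₁ → lhs l₁ l₂ l₃)
            ≈⟨ ∑-cong N (λ l₂ → ∑-cong N λ l₃ → ∑-factor N (W (η * t₂) (η * t₃) ηt₂-ηt₃ a₃ a₂ l₃ l₂)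
                 (λ l₁ → W t₁ t₃ t₁-t₃ l₃ a₁ b₃ l₁) (λ l₁ → W (η * t₁) (η * t₂) ηt₁-ηt₂ l₂ l₁ b₂ b₁)) ⟩
          ∑ N (λ l₂ → ∑ N λ l₃ → W (η * t₂) (η * t₃) ηt₂-ηt₃ a₃ a₂ l₃ l₂ * rest l₃ l₂)
            ≈⟨ ηW₂₃.∑-outgoing a₂ rest (ℕ.s≤s a₃+a₂≤A) ⟩
          L a₃ * qsum a₃ (λ l₂ s₂ → weight μ (ρ * y) l₂ s₂ * rest (s₂ ℕ.+ a₂) l₂)
            ≈⟨ *-congˡ (qsum-cong-∣ a₃ λ l₂ s₂ e → *-congˡ (rest≈ l₂ s₂ e)) ⟩
          _
            ≈⟨ *-congˡ (expect-compose I-inv J-inv K-inv h a₃ a₂) ⟩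
          L a₃ * middle ∎
          where
          rest : ℕ → ℕ → Carrier
          rest l₃ l₂ = ∑ N λ l₁ →
            W t₁ t₃ t₁-t₃ l₃ a₁ b₃ l₁ * W (η * t₁) (η * t₂) ηt₁-ηt₂ l₂ l₁ b₂ b₁
          a₃+a₂≤A : a₃ ℕ.+ a₂ ℕ.≤ A
          a₃+a₂≤A = ≡.subst (a₃ ℕ.+ a₂ ℕ.≤_)
            (ℕ-solve 3 (λ a b c → a ℕ:+ (c ℕ:+ b) ℕ:= a ℕ:+ b ℕ:+ c) ≡.refl a₁ a₂ a₃)
            (ℕₚ.m≤n+m _ a₁)
          conserved : ∀ {l₂ s₂ l₁ s₁ b v} → l₂ ℕ.+ s₂ ≡ a₃ → l₁ ℕ.+ s₁ ≡ s₂ ℕ.+ a₂ → b ℕ.+ v ≡ l₂ →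
            b ℕ.+ (v ℕ.+ l₁) ℕ.+ (s₁ ℕ.+ a₁) ≡ A
          conserved {_} {s₂} {l₁} {s₁} {b} {v} ≡.refl e ≡.refl = ≡.trans
            (ℕ-solve 5 (λ b v l s a → b ℕ:+ (v ℕ:+ l) ℕ:+ (s ℕ:+ a) ℕ:= b ℕ:+ v ℕ:+ a ℕ:+ (l ℕ:+ s))
              ≡.refl b v l₁ s₁ a₁)
            (≡.trans (≡.cong (b ℕ.+ v ℕ.+ a₁ ℕ.+_) e)
              (ℕ-solve 5 (λ b v a s c → b ℕ:+ v ℕ:+ a ℕ:+ (s ℕ:+ c) ℕ:= a ℕ:+ c ℕ:+ (b ℕ:+ v ℕ:+ s))
                ≡.refl b v a₁ s₂ a₂))
          rest≈ : ∀ l₂ s₂ → l₂ ℕ.+ s₂ ≡ a₃ → rest (s₂ ℕ.+ a₂) l₂ ≈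
            J (s₂ ℕ.+ a₂) * qsum (s₂ ℕ.+ a₂) λ l₁ s₁ → weight (μ * ρ) x l₁ s₁ *
              (K l₂ * qsum l₂ λ b v → weight ρ y b v * h b (v ℕ.+ l₁))
          rest≈ l₂ s₂ e = trans
            (W₁₃.∑-outgoing-l a₁ b₃ (λ l₁ → W (η * t₁) (η * t₂) ηt₁-ηt₂ l₂ l₁ b₂ b₁)
              (ℕ.s≤s (ℕₚ.≤-trans (ℕₚ.+-monoˡ-≤ a₂ (≡.subst (s₂ ℕ.≤_) e (ℕₚ.m≤n+m s₂ l₂))) a₃+a₂≤A)))
            (*-congˡ (qsum-cong-∣ (s₂ ℕ.+ a₂) λ l₁ s₁ e′ → *-congˡ (begin
              δ (s₁ ℕ.+ a₁) b₃ * W (η * t₁) (η * t₂) ηt₁-ηt₂ l₂ l₁ b₂ b₁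
                ≈⟨ *-congˡ (ηW₁₂.W-qsum l₂ l₁ b₂ b₁) ⟩
              δ (s₁ ℕ.+ a₁) b₃ * (K l₂ * qsum l₂ λ b v → weight ρ y b v * (δ b b₁ * δ (v ℕ.+ l₁) b₂))
                ≈⟨ trans (solve 3 (λ a b c → a :* (b :* c) := b :* (a :* c)) refl _ _ _)
                     (*-congˡ (*-qsum l₂ _ _)) ⟩
              K l₂ * qsum l₂ (λ b v →
                δ (s₁ ℕ.+ a₁) b₃ * (weight ρ y b v * (δ b b₁ * δ (v ℕ.+ l₁) b₂)))
                ≈⟨ *-congˡ (qsum-cong-∣ l₂ λ b v e″ → trans
                     (*-congʳ (third-arrow {b} {v ℕ.+ l₁} {s₁ ℕ.+ a₁} (conserved {l₂} {s₂} {l₁} {s₁} {b} {v} e e′ e″)))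
                     (solve 4 (λ d w a b → d :* (w :* (a :* b)) := w :* (a :* (b :* d))) refl _ _ _ _)) ⟩
              K l₂ * qsum l₂ (λ b v → weight ρ y b v * h b (v ℕ.+ l₁)) ∎)))

        rhs≈middle : ∑ N (λ l₁ → ∑ N λ l₂ → ∑ N λ l₃ → rhs l₁ l₂ l₃) ≈ L a₃ * middle
        rhs≈middle = begin
          ∑ N (λ l₁ → ∑ N λ l₂ → ∑ N λ l₃ → rhs l₁ l₂ l₃)
            ≈⟨ ∑-cong N (λ l₁ → ∑-cong N λ l₂ → ∑-factor N (W t₁ t₂ t₁-t₂ a₂ a₁ l₂ l₁)
                 (λ l₃ → W (η * t₁) (η * t₃) ηt₁-ηt₃ a₃ l₁ l₃ b₁) (λ l₃ → W t₂ t₃ t₂-t₃ l₃ l₂ b₃ b₂)) ⟩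
          ∑ N (λ l₁ → ∑ N λ l₂ → W t₁ t₂ t₁-t₂ a₂ a₁ l₂ l₁ * rest l₂ l₁)
            ≈⟨ W₁₂.∑-outgoing a₁ rest (ℕ.s≤s a₂+a₁≤A) ⟩
          I a₂ * qsum a₂ (λ l s → weight ρ x l s * rest (s ℕ.+ a₁) l)
            ≈⟨ *-congˡ (qsum-cong-∣ a₂ λ l s e → trans (*-congˡ (rest≈ l s e))
                 (solve 3 (λ w k f → w :* (k :* f) := k :* (w :* f)) refl _ _ _)) ⟩
          I a₂ * qsum a₂ (λ l s → L a₃ * (weight ρ x l s * inner l))
            ≈⟨ *-congˡ (*-qsum a₂ _ _) ⟨
          I a₂ * (L a₃ * qsum a₂ (λ l s → weight ρ x l s * inner l))
            ≈⟨ solve 3 (λ a b c → a :* (b :* c) := b :* (a :* c)) refl _ _ _ ⟩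
          L a₃ * middle ∎
          where
          rest : ℕ → ℕ → Carrier
          rest l₂ l₁ = ∑ N λ l₃ →
            W (η * t₁) (η * t₃) ηt₁-ηt₃ a₃ l₁ l₃ b₁ * W t₂ t₃ t₂-t₃ l₃ l₂ b₃ b₂
          inner : ℕ → Carrier
          inner l = qsum a₃ λ b m →
            weight (μ * ρ) y b m * (J (m ℕ.+ l) * expect μ (ρ * x) (m ℕ.+ l) (h b))
          a₂+a₁≤A : a₂ ℕ.+ a₁ ℕ.≤ A
          a₂+a₁≤A = ≡.subst (ℕ._≤ A) (ℕₚ.+-comm a₁ a₂) (ℕₚ.m≤m+n _ a₃)
          a₃+l≤A : ∀ l s → l ℕ.+ s ≡ a₂ → a₃ ℕ.+ l ℕ.≤ A
          a₃+l≤A l s ≡.refl = ≡.subst (a₃ ℕ.+ l ℕ.≤_)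
            (ℕ-solve 4 (λ a l s c → c ℕ:+ l ℕ:+ (a ℕ:+ s) ℕ:= a ℕ:+ (l ℕ:+ s) ℕ:+ c) ≡.refl a₁ l s a₃)
            (ℕₚ.m≤m+n _ _)
          conserved : ∀ {l s b m d v} → l ℕ.+ s ≡ a₂ → b ℕ.+ m ≡ a₃ → d ℕ.+ v ≡ m ℕ.+ l →
            b ℕ.+ d ℕ.+ (v ℕ.+ (s ℕ.+ a₁)) ≡ A
          conserved {l} {s} {b} {m} {d} {v} ≡.refl ≡.refl e = ≡.trans
            (ℕ-solve 5 (λ b d v s a → b ℕ:+ d ℕ:+ (v ℕ:+ (s ℕ:+ a)) ℕ:= b ℕ:+ s ℕ:+ a ℕ:+ (d ℕ:+ v))
              ≡.refl b d v s a₁)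
            (≡.trans (≡.cong (b ℕ.+ s ℕ.+ a₁ ℕ.+_) e)
              (ℕ-solve 5 (λ b s a m l → b ℕ:+ s ℕ:+ a ℕ:+ (m ℕ:+ l) ℕ:= a ℕ:+ (l ℕ:+ s) ℕ:+ (b ℕ:+ m))
                ≡.refl b s a₁ m l))
          rest≈ : ∀ l s → l ℕ.+ s ≡ a₂ → rest (s ℕ.+ a₁) l ≈ L a₃ * inner l
          rest≈ l s e = trans
            (ηW₁₃.∑-outgoing-k l b₁ (λ l₃ → W t₂ t₃ t₂-t₃ l₃ (s ℕ.+ a₁) b₃ b₂) (ℕ.s≤s (a₃+l≤A l s e)))
            (*-congˡ (qsum-cong-∣ a₃ λ b m e′ → *-congˡ (begin
              δ b b₁ * W t₂ t₃ t₂-t₃ (m ℕ.+ l) (s ℕ.+ a₁) b₃ b₂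
                ≈⟨ *-congˡ (W₂₃.W-qsum (m ℕ.+ l) (s ℕ.+ a₁) b₃ b₂) ⟩
              δ b b₁ * (J (m ℕ.+ l) * qsum (m ℕ.+ l) λ d v →
                weight μ (ρ * x) d v * (δ d b₂ * δ (v ℕ.+ (s ℕ.+ a₁)) b₃))
                ≈⟨ trans (solve 3 (λ a b c → a :* (b :* c) := b :* (a :* c)) refl _ _ _)
                     (*-congˡ (*-qsum (m ℕ.+ l) _ _)) ⟩
              J (m ℕ.+ l) * qsum (m ℕ.+ l) (λ d v →
                δ b b₁ * (weight μ (ρ * x) d v * (δ d b₂ * δ (v ℕ.+ (s ℕ.+ a₁)) b₃)))
                ≈⟨ *-congˡ (qsum-cong-∣ (m ℕ.+ l) λ d v e″ → trans
                     (solve 4 (λ d w a b → d :* (w :* (a :* b)) := w :* (d :* (a :* b))) refl _ _ _ _)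
                     (*-congˡ (*-congˡ (*-congˡ
                       (third-arrow {b} {d} {v ℕ.+ (s ℕ.+ a₁)} (conserved {l} {s} {b} {m} {d} {v} e e′ e″)))))) ⟩
              J (m ℕ.+ l) * expect μ (ρ * x) (m ℕ.+ l) (h b) ∎)))

      yang-baxter : ∑ N (λ l₁ → ∑ N λ l₂ → ∑ N λ l₃ → lhs l₁ l₂ l₃) ≈
        ∑ N (λ l₁ → ∑ N λ l₂ → ∑ N λ l₃ → rhs l₁ l₂ l₃)
      yang-baxter = trans lhs≈middle (sym rhs≈middle)

proposition3p1 : ∀ {c ℓ ℓ₂ : Level} (K : HeytingField c ℓ ℓ₂)
    (q : HeytingField.Carrier K) (q-generic : Generic K q)
    (a₁ a₂ a₃ b₁ b₂ b₃ : ℕ) →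
    let open RationalFunctions K
        open RingOps rationalFunctions
        open RationalFunctions.Parameters K q q-generic
        open Support a₁ a₂ a₃ b₁ b₂ b₃
    in
      ∑ℕ³ (λ l₁ l₂ l₃ →
             W (η * t₂) (η * t₃) ηt₂-ηt₃ a₃ a₂ l₃ l₂
           * W t₁ t₃ t₁-t₃ l₃ a₁ b₃ l₁
           * W (η * t₁) (η * t₂) ηt₁-ηt₂ l₂ l₁ b₂ b₁)
          (lhs-finite ηt₂-ηt₃ t₁-t₃ ηt₁-ηt₂)
      ≈
      ∑ℕ³ (λ l₁ l₂ l₃ →
             W t₁ t₂ t₁-t₂ a₂ a₁ l₂ l₁
           * W (η * t₁) (η * t₃) ηt₁-ηt₃ a₃ l₁ l₃ b₁
           * W t₂ t₃ t₂-t₃ l₃ l₂ b₃ b₂)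
          (rhs-finite t₁-t₂ ηt₁-ηt₃ t₂-t₃)
proposition3p1 K q₀ q-generic a₁ a₂ a₃ b₁ b₂ b₃ =
  YangBaxter.yang-baxter rationalFunctions q qPoch-inv {t₁} {t₂} {t₃} {η}
    t₁-t₂ t₁-t₃ t₂-t₃ ηt₁-ηt₂ ηt₁-ηt₃ ηt₂-ηt₃ a₁ a₂ a₃ b₁ b₂ b₃
  where
  open RationalFunctions K
  open RationalFunctions.Parameters K q₀ q-generic
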